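{- Fix a signature and an inductive definition set $\Phi$. Let $\mathrm{Pr}$ be a $\mathrm{CLKID}^\omega$ proof of $\Gamma\vdash\Delta$ in which every substitution used in an instance of $(\mathrm{Subst})$ is atomic. Then there is a $\mathrm{CLKID}^\omega$ proof of $\Gamma\vdash\Delta$ containing no instance of $(\mathrm{Subst})$ and using only inference rules that occur in $\mathrm{Pr}$.
   Context: A substitution (finite map from variables to terms) is atomic if its image contains only variables and constant symbols. Language. Terms are built from variables and function symbols of fixed arity (nullary ones are constants). Predicate symbols: equality $=$, ordinary predicate symbols $Q$, inductive predicate symbols $P$. Formulas: $\phi::=P(\vec t)\mid Q(\vec u)\mid t=u\mid\lnot\phi\mid\phi\vee\phi\mid\phi\wedge\phi\mid\phi\to\phi\mid\exists x.\phi\mid\forall x.\phi$, up to $\alpha$-equivalence. An inductive definition set $\Phi$ is a finite set of productions $\dfrac{Q_1(\vec{u_1}(\vec x))\ \cdots\ Q_n(\vec{u_n}(\vec x))\ P_1(\vec{t_1}(\vec x))\ \cdots\ P_m(\vec{t_m}(\vec x))}{P(\vec t(\vec x))}$. Sequents $\Gamma\vdash\Delta$ have finite sets of formulas on each side; $\phi[\theta]$ is capture-avoiding substitution. Rules of $\mathrm{CLKID}^\omega$: $(\mathrm{Axiom})$: $\Gamma\vdash\Delta$ if $\Gamma\cap\Delta\neq\emptyset$; $(=\mathrm{R})$: $\Gamma\vdash t=t,\Delta$; $(\mathrm{Wk})$; $(\mathrm{Cut})$: from $\Gamma\vdash\phi,\Delta$ and $\Gamma,\phi\vdash\Delta$ infer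 $\Gamma\vdash\Delta$; $(\mathrm{Subst})$: from $\Gamma\vdash\Delta$ infer $\Gamma[\theta]\vdash\Delta[\theta]$; standard LK rules for $\lnot,\vee,\wedge,\to$; $(\forall\mathrm{L})$, $(\exists\mathrm{R})$ with arbitrary witness term $t$; $(\forall\mathrm{R})$, $(\exists\mathrm{L})$ with fresh eigenvariable $y$; $(=\mathrm{L})$: from $\Gamma[u/x,t/y]\vdash\Delta[u/x,t/y]$ infer $\Gamma[t/x,u/y],t=u\vdash\Delta[t/x,u/y]$; $(\mathrm{UL})$: from $\Gamma,P(\vec u)\vdash\Delta$ one premise per production of $P$, namely $\Gamma,\vec u=\vec t(\vec y),Q_1(\vec{u_1}(\vec y)),\dots,P_m(\vec{t_m}(\vec y))\vdash\Delta$ with $\vec y$ fresh; $(\mathrm{UR})$: for a production, from $\Gamma\vdash Q_i(\vec{u_i}(\vec u)),\Delta$ and $\Gamma\vdash P_j(\vec{t_j}(\vec u)),\Delta$ for all $i,j$ infer $\Gamma\vdash P(\vec t(\vec u)),\Delta$. A pre-proof is a finite derivation tree whose leaves are axiom instances or buds, each bud being assigned a companion (an internal node labelled by the identical sequent). Paths follow conclusion-to-premise edges and bud-to-companion edges. A trace along a path $(e_i)$ is a sequence of occurrences $C_i$ of inductive atoms in the antecedents of $e_i$ where: if $e_i$ is the conclusion of $(\mathrm{UL})$ unfolding $C_i$, then $C_{i+1}$ is an inductive atom introduced by that unfolding and $i$ is a progressing point; otherwise $C_{i+1}$ is the occurrence corresponding to $C_i$. A proof is a pre-proof in which every infinite path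 has a tail with a trace having infinitely many progressing points (global trace condition). -}

module Defs where

open import Data.Nat using (ℕ; zero; suc; _≤_; _≡ᵇ_)
open import Data.Bool using (Bool; true; false; if_then_else_)
open import Data.Fin using (Fin)
open import Data.Vec as Vec using (Vec; []; _∷_; toList)
open import Data.List as List using (List; []; _∷_; _++_; length; lookup; map; zipWith)
open import Data.List.Membership.Propositional using (_∈_)
open import Data.List.Relation.Unary.All using (All)
open import Data.Product using (Σ; ∃; _×_; _,_)
open import Data.Sum using (_⊎_)
open import Data.Unit using (⊤)
open import Data.Empty using (⊥)
open import Relation.Nullary using (¬_)
open import Relation.Binary.PropositionalEquality using (_≡_)
open import Function.Definitions using (Injective)

-- Signatures: function symbols (nullary = constants), ordinary
-- predicate symbols Q, inductive predicate symbols P, each with arity.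

record Signature : Set₁ where
  field
    Fun   : Set
    arF   : Fun → ℕ
    OPred : Set
    arQ   : OPred → ℕ
    IPred : Set
    arP   : IPred → ℕ

module Syntax (S : Signature) where
  open Signature S

  data Term (V : Set) : Set where
    var : V → Term V
    fn  : (f : Fun) → Vec (Term V) (arF f) → Term V

  mutual
    bindT : ∀ {A B : Set} → (A → Term B) → Term A → Term B
    bindT σ (var x)   = σ x
    bindT σ (fn f ts) = fn f (bindV σ ts)

    bindV : ∀ {A B : Set} {n} → (A → Term B) → Vec (Term A) n → Vec (Term B) n
    bindV σ []       = []
    bindV σ (t ∷ ts) = bindT σ t ∷ bindV σ ts

  IsVarOrConst : Term ℕ → Set
  IsVarOrConst (var _)   = ⊤
  IsVarOrConst (fn f _)  = arF f ≡ 0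

  mutual
    FreeT : ℕ → Term ℕ → Set
    FreeT x (var y)   = x ≡ y
    FreeT x (fn f ts) = FreeV x ts

    FreeV : ∀ {n} → ℕ → Vec (Term ℕ) n → Set
    FreeV x []       = ⊥
    FreeV x (t ∷ ts) = FreeT x t ⊎ FreeV x ts

  -- Formulas, with variables in de Bruijn representation (so formulas are
  -- taken literally up to α-equivalence).  Inside a quantifier, index 0 is
  -- the bound variable and index (suc n) is the variable n of the outside.
  data Formula : Set where
    ind  : (p : IPred) → Vec (Term ℕ) (arP p) → Formula
    ord  : (q : OPred) → Vec (Term ℕ) (arQ q) → Formula
    _≐_  : Term ℕ → Term ℕ → Formula
    ¬'   : Formula → Formula
    _∨'_ : Formula → Formula → Formula
    _∧'_ : Formula → Formula → Formula
    _⇒'_ : Formula → Formula → Formula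
    ∃'   : Formula → Formula
    ∀'   : Formula → Formula

  IsIndAtom : Formula → Set
  IsIndAtom (ind _ _) = ⊤
  IsIndAtom _         = ⊥

  FreeF : ℕ → Formula → Set
  FreeF x (ind p ts) = FreeV x ts
  FreeF x (ord q ts) = FreeV x ts
  FreeF x (t ≐ u)    = FreeT x t ⊎ FreeT x u
  FreeF x (¬' φ)     = FreeF x φ
  FreeF x (φ ∨' ψ)   = FreeF x φ ⊎ FreeF x ψ
  FreeF x (φ ∧' ψ)   = FreeF x φ ⊎ FreeF x ψ
  FreeF x (φ ⇒' ψ)   = FreeF x φ ⊎ FreeF x ψ
  FreeF x (∃' φ)     = FreeF (suc x) φ
  FreeF x (∀' φ)     = FreeF (suc x) φ

  ⇑ : (ℕ → Term ℕ) → ℕ → Term ℕ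
  ⇑ σ zero    = var zero
  ⇑ σ (suc n) = bindT (λ m → var (suc m)) (σ n)

  substF : (ℕ → Term ℕ) → Formula → Formula
  substF σ (ind p ts) = ind p (bindV σ ts)
  substF σ (ord q ts) = ord q (bindV σ ts)
  substF σ (t ≐ u)    = bindT σ t ≐ bindT σ u
  substF σ (¬' φ)     = ¬' (substF σ φ)
  substF σ (φ ∨' ψ)   = substF σ φ ∨' substF σ ψ
  substF σ (φ ∧' ψ)   = substF σ φ ∧' substF σ ψ
  substF σ (φ ⇒' ψ)   = substF σ φ ⇒' substF σ ψ
  substF σ (∃' φ)     = ∃' (substF (⇑ σ) φ)
  substF σ (∀' φ)     = ∀' (substF (⇑ σ) φ)

  _[_]₀ : Formula → Term ℕ → Formula
  φ [ t ]₀ = substF σ φ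
    where σ : ℕ → Term ℕ
          σ zero    = t
          σ (suc n) = var n

  Substitution : Set
  Substitution = List (ℕ × Term ℕ)

  ⟦_⟧ : Substitution → ℕ → Term ℕ
  ⟦ [] ⟧ x = var x
  ⟦ (y , t) ∷ θ ⟧ x = if x ≡ᵇ y then t else ⟦ θ ⟧ x

  Atomic : Substitution → Set
  Atomic θ = All (λ p → IsVarOrConst (Data.Product.proj₂ p)) θ

  _/_,_/_ : Term ℕ → ℕ → Term ℕ → ℕ → ℕ → Term ℕ
  (t / x , u / y) n = if n ≡ᵇ x then t else (if n ≡ᵇ y then u else var n)

  -- Sequents: finite sets of formulas, represented by lists up to
  -- set-equality.
  record Sequent : Set where
    constructor _⊢_
    field
      ante : List Formula
      succ : List Formula
  open Sequent public

  _⊆L_ : List Formula → List Formula → Set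
  A ⊆L B = ∀ φ → φ ∈ A → φ ∈ B

  _≈L_ : List Formula → List Formula → Set
  A ≈L B = (A ⊆L B) × (B ⊆L A)

  _≈S_ : Sequent → Sequent → Set
  s ≈S s' = (ante s ≈L ante s') × (succ s ≈L succ s')

  FreeIn : ℕ → List Formula → Set
  FreeIn x Γ = Σ Formula λ φ → φ ∈ Γ × FreeF x φ

  -- Productions of an inductive definition set, over k variables x₀…x_{k-1}:
  --   Q₁(u₁(x)) … Qₙ(uₙ(x))  P₁(t₁(x)) … Pₘ(tₘ(x))
  --                 P(t(x))
  record Production : Set where
    field
      k     : ℕ
      qs    : List (Σ OPred λ q → Vec (Term (Fin k)) (arQ q))
      ps    : List (Σ IPred λ p → Vec (Term (Fin k)) (arP p))
      head  : IPred
      targs : Vec (Term (Fin k)) (arP head)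

  module _ (pr : Production) (σ : Fin (Production.k pr) → Term ℕ) where
    open Production pr
    QAtoms : List Formula
    QAtoms = map (λ a → ord (Data.Product.proj₁ a) (bindV σ (Data.Product.proj₂ a))) qs
    PAtoms : List Formula
    PAtoms = map (λ a → ind (Data.Product.proj₁ a) (bindV σ (Data.Product.proj₂ a))) ps
    HeadAtom : Formula
    HeadAtom = ind head (bindV σ targs)
    HeadEqs : ∀ {n} → Vec (Term ℕ) n → List Formula
    HeadEqs us = zipWith _≐_ (toList us) (toList (bindV σ targs))

data RuleName : Set where
  Axiom EqR Wk Cut Subst NegL NegR OrL OrR AndL AndR ImpL ImpR
    AllL AllR ExL ExR EqL UL UR : RuleName

module Calculus (S : Signature) (Φ : List (Syntax.Production S)) where
  open Signature S
  open Syntax S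

  data Rule : Set where
    axiom  : (Γ Δ : List Formula) → Σ Formula (λ φ → φ ∈ Γ × φ ∈ Δ) → Rule
    eqR    : (Γ Δ : List Formula) (t : Term ℕ) → Rule
    wk     : (Γ Δ Γ' Δ' : List Formula) → Γ' ⊆L Γ → Δ' ⊆L Δ → Rule
    cut    : (Γ Δ : List Formula) (φ : Formula) → Rule
    subst  : (θ : Substitution) (Γ Δ : List Formula) → Rule
    negL negR : (Γ Δ : List Formula) (φ : Formula) → Rule
    orL orR andL andR impL impR : (Γ Δ : List Formula) (φ ψ : Formula) → Rule
    allL exR : (Γ Δ : List Formula) (φ : Formula) (t : Term ℕ) → Rule
    allR : (Γ Δ : List Formula) (φ : Formula) (y : ℕ) →
           ¬ FreeIn y (Γ ++ ∀' φ ∷ Δ) → Rule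
    exL  : (Γ Δ : List Formula) (φ : Formula) (y : ℕ) →
           ¬ FreeIn y (∃' φ ∷ Γ ++ Δ) → Rule
    eqL  : (Γ Δ : List Formula) (x y : ℕ) (t u : Term ℕ) → Rule
    unfoldL : (Γ Δ : List Formula) (p : IPred) (us : Vec (Term ℕ) (arP p))
              (ys : (j : Σ (Fin (length Φ)) λ j → Production.head (lookup Φ j) ≡ p) →
                    Fin (Production.k (lookup Φ (Data.Product.proj₁ j))) → ℕ) →
              (∀ j → Injective _≡_ _≡_ (ys j)) →
              (∀ j i → ¬ FreeIn (ys j i) (ind p us ∷ Γ ++ Δ)) → Rule
    unfoldR : (Γ Δ : List Formula) (j : Fin (length Φ))
              (us : Fin (Production.k (lookup Φ j)) → Term ℕ) → Rule

  name : Rule → RuleName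
  name (axiom _ _ _) = Axiom
  name (eqR _ _ _) = EqR
  name (wk _ _ _ _ _ _) = Wk
  name (cut _ _ _) = Cut
  name (subst _ _ _) = Subst
  name (negL _ _ _) = NegL
  name (negR _ _ _) = NegR
  name (orL _ _ _ _) = OrL
  name (orR _ _ _ _) = OrR
  name (andL _ _ _ _) = AndL
  name (andR _ _ _ _) = AndR
  name (impL _ _ _ _) = ImpL
  name (impR _ _ _ _) = ImpR
  name (allL _ _ _ _) = AllL
  name (exR _ _ _ _) = ExR
  name (allR _ _ _ _ _) = AllR
  name (exL _ _ _ _ _) = ExL
  name (eqL _ _ _ _ _ _) = EqL
  name (unfoldL _ _ _ _ _ _ _) = UL
  name (unfoldR _ _ _ _) = UR

  URAtoms : (j : Fin (length Φ)) → (Fin (Production.k (lookup Φ j)) → Term ℕ) → List Formula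
  URAtoms j us = QAtoms (lookup Φ j) us ++ PAtoms (lookup Φ j) us

  PremIx : Rule → Set
  PremIx (axiom _ _ _) = Fin 0
  PremIx (eqR _ _ _) = Fin 0
  PremIx (wk _ _ _ _ _ _) = Fin 1
  PremIx (cut _ _ _) = Fin 2
  PremIx (subst _ _ _) = Fin 1
  PremIx (negL _ _ _) = Fin 1
  PremIx (negR _ _ _) = Fin 1
  PremIx (orL _ _ _ _) = Fin 2
  PremIx (orR _ _ _ _) = Fin 1
  PremIx (andL _ _ _ _) = Fin 1
  PremIx (andR _ _ _ _) = Fin 2
  PremIx (impL _ _ _ _) = Fin 2
  PremIx (impR _ _ _ _) = Fin 1
  PremIx (allL _ _ _ _) = Fin 1
  PremIx (exR _ _ _ _) = Fin 1
  PremIx (allR _ _ _ _ _) = Fin 1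
  PremIx (exL _ _ _ _ _) = Fin 1
  PremIx (eqL _ _ _ _ _ _) = Fin 1
  PremIx (unfoldL _ _ p _ _ _ _) = Σ (Fin (length Φ)) λ j → Production.head (lookup Φ j) ≡ p
  PremIx (unfoldR _ _ j us) = Fin (length (URAtoms j us))

  two : ∀ {A : Set} → A → A → Fin 2 → A
  two a b Fin.zero = a
  two a b (Fin.suc _) = b

  conclusion : Rule → Sequent
  conclusion (axiom Γ Δ _) = Γ ⊢ Δ
  conclusion (eqR Γ Δ t) = Γ ⊢ ((t ≐ t) ∷ Δ)
  conclusion (wk Γ Δ _ _ _ _) = Γ ⊢ Δ
  conclusion (cut Γ Δ _) = Γ ⊢ Δ
  conclusion (subst θ Γ Δ) = map (substF ⟦ θ ⟧) Γ ⊢ map (substF ⟦ θ ⟧) Δ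
  conclusion (negL Γ Δ φ) = (¬' φ ∷ Γ) ⊢ Δ
  conclusion (negR Γ Δ φ) = Γ ⊢ (¬' φ ∷ Δ)
  conclusion (orL Γ Δ φ ψ) = ((φ ∨' ψ) ∷ Γ) ⊢ Δ
  conclusion (orR Γ Δ φ ψ) = Γ ⊢ ((φ ∨' ψ) ∷ Δ)
  conclusion (andL Γ Δ φ ψ) = ((φ ∧' ψ) ∷ Γ) ⊢ Δ
  conclusion (andR Γ Δ φ ψ) = Γ ⊢ ((φ ∧' ψ) ∷ Δ)
  conclusion (impL Γ Δ φ ψ) = ((φ ⇒' ψ) ∷ Γ) ⊢ Δ
  conclusion (impR Γ Δ φ ψ) = Γ ⊢ ((φ ⇒' ψ) ∷ Δ)
  conclusion (allL Γ Δ φ t) = (∀' φ ∷ Γ) ⊢ Δ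
  conclusion (exR Γ Δ φ t) = Γ ⊢ (∃' φ ∷ Δ)
  conclusion (allR Γ Δ φ y _) = Γ ⊢ (∀' φ ∷ Δ)
  conclusion (exL Γ Δ φ y _) = (∃' φ ∷ Γ) ⊢ Δ
  conclusion (eqL Γ Δ x y t u) =
    ((t ≐ u) ∷ map (substF (t / x , u / y)) Γ) ⊢ map (substF (t / x , u / y)) Δ
  conclusion (unfoldL Γ Δ p us _ _ _) = (ind p us ∷ Γ) ⊢ Δ
  conclusion (unfoldR Γ Δ j us) = Γ ⊢ (HeadAtom (lookup Φ j) us ∷ Δ)

  ULinst : ∀ {p} (ys : (j : Σ (Fin (length Φ)) λ j → Production.head (lookup Φ j) ≡ p) →
                    Fin (Production.k (lookup Φ (Data.Product.proj₁ j))) → ℕ) →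
           (j : Σ (Fin (length Φ)) λ j → Production.head (lookup Φ j) ≡ p) →
           Fin (Production.k (lookup Φ (Data.Product.proj₁ j))) → Term ℕ
  ULinst ys j i = var (ys j i)

  premise : (r : Rule) → PremIx r → Sequent
  premise (wk _ _ Γ' Δ' _ _) _ = Γ' ⊢ Δ'
  premise (cut Γ Δ φ) = two (Γ ⊢ (φ ∷ Δ)) ((φ ∷ Γ) ⊢ Δ)
  premise (subst θ Γ Δ) _ = Γ ⊢ Δ
  premise (negL Γ Δ φ) _ = Γ ⊢ (φ ∷ Δ)
  premise (negR Γ Δ φ) _ = (φ ∷ Γ) ⊢ Δ
  premise (orL Γ Δ φ ψ) = two ((φ ∷ Γ) ⊢ Δ) ((ψ ∷ Γ) ⊢ Δ)
  premise (orR Γ Δ φ ψ) _ = Γ ⊢ (φ ∷ ψ ∷ Δ)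
  premise (andL Γ Δ φ ψ) _ = (φ ∷ ψ ∷ Γ) ⊢ Δ
  premise (andR Γ Δ φ ψ) = two (Γ ⊢ (φ ∷ Δ)) (Γ ⊢ (ψ ∷ Δ))
  premise (impL Γ Δ φ ψ) = two (Γ ⊢ (φ ∷ Δ)) ((ψ ∷ Γ) ⊢ Δ)
  premise (impR Γ Δ φ ψ) _ = (φ ∷ Γ) ⊢ (ψ ∷ Δ)
  premise (allL Γ Δ φ t) _ = ((φ [ t ]₀) ∷ Γ) ⊢ Δ
  premise (exR Γ Δ φ t) _ = Γ ⊢ ((φ [ t ]₀) ∷ Δ)
  premise (allR Γ Δ φ y _) _ = Γ ⊢ ((φ [ var y ]₀) ∷ Δ)
  premise (exL Γ Δ φ y _) _ = ((φ [ var y ]₀) ∷ Γ) ⊢ Δ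
  premise (eqL Γ Δ x y t u) _ =
    map (substF (u / x , t / y)) Γ ⊢ map (substF (u / x , t / y)) Δ
  premise (unfoldL Γ Δ p us ys _ _) j =
    let pr = lookup Φ (Data.Product.proj₁ j) ; σ = ULinst ys j in
    (Γ ++ HeadEqs pr σ us ++ QAtoms pr σ ++ PAtoms pr σ) ⊢ Δ
  premise (unfoldR Γ Δ j us) i = Γ ⊢ (lookup (URAtoms j us) i ∷ Δ)

  -- Trace correspondence: occurrence C (in the antecedent of the
  -- conclusion) is followed by C' (in the antecedent of premise i);
  -- the Bool records whether this is a progressing point.
  Corr : (r : Rule) → PremIx r → Formula → Formula → Bool → Set
  Corr (subst θ Γ Δ) _ C C' b = (b ≡ false) × (C ≡ substF ⟦ θ ⟧ C')
  Corr (eqL Γ Δ x y t u) _ C C' b =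
    (b ≡ false) × Σ Formula (λ D → D ∈ Γ × C ≡ substF (t / x , u / y) D
                                          × C' ≡ substF (u / x , t / y) D)
  Corr (unfoldL Γ Δ p us ys _ _) j C C' b =
    ((b ≡ false) × (C' ≡ C))
    ⊎ ((b ≡ true) × (C ≡ ind p us) × (C' ∈ PAtoms (lookup Φ (Data.Product.proj₁ j)) (ULinst ys j)))
  Corr _ _ C C' b = (b ≡ false) × (C' ≡ C)

  data Tree : Set where
    inf : (s : Sequent) (r : Rule) → (PremIx r → Tree) → Tree
    bud : (s : Sequent) → Tree

  label : Tree → Sequent
  label (inf s _ _) = s
  label (bud s) = s

  Valid : Tree → Set
  Valid (inf s r ts) = (s ≈S conclusion r) × (∀ i → (label (ts i) ≈S premise r i) × Valid (ts i))
  Valid (bud s) = ⊤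

  IsBud : Tree → Set
  IsBud (bud _) = ⊤
  IsBud (inf _ _ _) = ⊥

  IsInf : Tree → Set
  IsInf (bud _) = ⊥
  IsInf (inf _ _ _) = ⊤

  data Pos : Tree → Set where
    here  : ∀ {t} → Pos t
    there : ∀ {s r ts} (i : PremIx r) → Pos (ts i) → Pos (inf s r ts)

  at : ∀ {t} → Pos t → Tree
  at {t} here = t
  at (there i p) = at p

  ChildIx : Tree → Set
  ChildIx (inf _ r _) = PremIx r
  ChildIx (bud _) = ⊥

  extend : ∀ {t} (p : Pos t) → ChildIx (at p) → Pos t
  extend {inf s r ts} here i = there i here
  extend {bud s} here ()
  extend (there j p) i = there j (extend p i)

  CorrT : (t : Tree) → ChildIx t → Formula → Formula → Bool → Set
  CorrT (inf _ r _) i = Corr r i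
  CorrT (bud _) ()

  record PreProof : Set where
    field
      tree      : Tree
      valid     : Valid tree
      companion : (p : Pos tree) → IsBud (at p) → Pos tree
      compInf   : ∀ p b → IsInf (at (companion p b))
      compSeq   : ∀ p b → label (at (companion p b)) ≈S label (at p)

    data Edge : Pos tree → Pos tree → Set where
      child : (p : Pos tree) (i : ChildIx (at p)) → Edge p (extend p i)
      toComp : (p : Pos tree) (b : IsBud (at p)) → Edge p (companion p b)

    data Step : Pos tree → Pos tree → Formula → Formula → Bool → Set where
      childS : (p : Pos tree) (i : ChildIx (at p)) {C C' : Formula} {b : Bool} →
               CorrT (at p) i C C' b → Step p (extend p i) C C' b
      compS  : (p : Pos tree) (bd : IsBud (at p)) (C : Formula) →
               Step p (companion p bd) C C false

    InfinitePath : (ℕ → Pos tree) → Set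
    InfinitePath e = ∀ k → Edge (e k) (e (suc k))

    InfProgTrace : (ℕ → Pos tree) → Set
    InfProgTrace e =
      Σ ℕ λ k₀ → Σ (ℕ → Formula) λ C → Σ (ℕ → Bool) λ prog →
        (∀ k → k₀ ≤ k →
           IsIndAtom (C k) × (C k ∈ ante (label (at (e k))))
           × Step (e k) (e (suc k)) (C k) (C (suc k)) (prog k))
        × (∀ m → Σ ℕ λ k → m ≤ k × k₀ ≤ k × prog k ≡ true)

    GlobalTraceCondition : Set
    GlobalTraceCondition = ∀ e → InfinitePath e → InfProgTrace e

  open PreProof public

  record Proof (s : Sequent) : Set where
    field
      preproof : PreProof
      root     : label (tree preproof) ≈S s
      gtc      : GlobalTraceCondition preproof
  open Proof public

  Uses : Tree → RuleName → Set
  Uses (inf _ r ts) n = (name r ≡ n) ⊎ Σ (PremIx r) λ i → Uses (ts i) n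
  Uses (bud _) n = ⊥

  SubstAtomicR : Rule → Set
  SubstAtomicR (subst θ _ _) = Atomic θ
  SubstAtomicR _ = ⊤

  AllSubstAtomic : Tree → Set
  AllSubstAtomic (inf _ r ts) = SubstAtomicR r × (∀ i → AllSubstAtomic (ts i))
  AllSubstAtomic (bud _) = ⊤

  UsesProof : ∀ {s} → Proof s → RuleName → Set
  UsesProof P n = Uses (tree (preproof P)) n

  SubstAtomicProof : ∀ {s} → Proof s → Set
  SubstAtomicProof P = AllSubstAtomic (tree (preproof P))

{-# OPTIONS --safe #-}
-- A substitution can be pushed upwards through every rule other than (Subst), after a renaming of the
-- eigenvariables, and a (Subst) instance is absorbed by composition.  Hence the infinite unfolding of
-- the cyclic proof can be relabelled by pairs (p , σ) of a position p of the given proof and a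
-- substitution σ on the free variables of its sequent.  All these σ are atomic, because the (Subst)
-- instances are, and eigenvariables can be chosen below a bound depending on p only; so there are
-- finitely many pairs, and cutting each branch at the first repetition gives a cyclic proof.  Its paths
-- project to paths of the given proof, along which traces are pulled back.
--
-- Constructively, the number of positions is not available, since whether a production is a premise of
-- (UL) depends on an undecided equality of predicate symbols.  Its role is played by the fact (Noeth)
-- that positions cannot be enumerated without repetition forever.
module Submission where

open import Defs
open import Data.Nat using (_+_; _<_; _≟_; _≡ᵇ_; _≤_; _⊔_; pred; suc; s≤s; zero; z≤n; ℕ)
open import Data.Nat.Properties using (+-identityʳ; +-monoʳ-<; +-suc; 1+n≢0; 1+n≰n; <⇒≢; m≤m+n; m≤m⊔n; m≤n+m; m≤n⇒∃[o]m+o≡n; m≤n⊔m; n<1+n; n≤1+n; suc-injective; ≡ᵇ⇒≡; ≤-<-trans; ≤-pred; ≤-refl; ≤-reflexive; ≤-trans)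
open import Data.Fin as Fin using (Fin; toℕ)
open import Data.Vec using (Vec; []; _∷_; tabulate; toList)
open import Data.List as List using (List; []; _++_; _∷_; cartesianProduct; concatMap; length; lookup; map; upTo; zipWith)
open import Data.List.Properties using (length-map; map-++; map-cong; map-cong-local; map-id-local; map-∘)
open import Data.List.Membership.Propositional using (_∈_; _∉_; find; lose)
open import Data.List.Membership.Propositional.Properties using (∈-++⁺ʳ; ∈-++⁺ˡ; ∈-cartesianProductWith⁺; ∈-cartesianProduct⁺; ∈-concatMap⁺; ∈-lookup; ∈-map⁺; ∈-map⁻; ∈-upTo⁺)
open import Data.List.Relation.Unary.Any as Any using (Any; here; index; there)
open import Data.List.Relation.Unary.All as All using (All; []; _∷_)
open import Data.Product using (_,_; _×_; proj₁; proj₂; Σ; ∃)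
open import Data.Sum as Sum using (_⊎_; inj₁; inj₂)
open import Data.Empty using (⊥; ⊥-elim)
open import Function using (_∘_; id)
open import Relation.Nullary using (no; yes; ¬_)
open import Relation.Binary.PropositionalEquality as ≡ using (_≡_; _≢_; cong; cong₂; refl; sym; trans)
open import Data.Bool using (Bool; T; _∨_; false; if_then_else_; true)
open import Data.Bool.Properties using (∨-identityʳ; ∨-zeroʳ)
open import Data.Unit using (tt; ⊤)
open import Data.Fin.Properties using (any?; injective⇒≤; pigeonhole; toℕ-injective; toℕ<n; ¬∀⟶∃¬)
open import Data.Nat.ListAction using (sum)
open import Function.Definitions using (Injective)
import Data.List.Membership.DecPropositional as DecMembership
open import Data.List.Relation.Unary.Any.Properties using (lookup-index)
open import Data.List.Relation.Unary.AllPairs using ([]; _∷_)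
open import Data.List.Relation.Unary.Unique.Propositional using (Unique)
open import Data.Vec.Properties as Vec using (length-toList)
open import Relation.Binary.Definitions using (DecidableEquality)
open import Data.List.Relation.Unary.All.Properties using (¬Any⇒All¬)
import Data.Product.Properties as Product

-- A state has to be compared with earlier ones, so σ is stored as a finite vector of codes, one
-- entry for each variable that can be free in the sequent. Composing with a non-atomic substitution
-- once per turn of a cycle would let terms grow forever. The bound on eigenvariables is a
-- pigeonhole: a vector mentions at most as many variables as it has entries, so a fresh one exists
-- below a number given by its length, however large those variables are.
--
-- (Subst) and bud edges of the given proof leave the instantiated sequent unchanged up to set
-- equality, so they produce no inference in the new one. A chain of them has to reach another rule;
-- the global trace condition forces this, since no such edge progresses.
--
-- A bud and its companion in the new proof share one state, and the edge between them projects to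
-- the empty path. The companion is an inference, however, and its outgoing edges project to
-- nonempty paths, so an infinite path projects to an infinite one. A traced atom C of the given
-- proof becomes its instance under σ; the renaming of eigenvariables does not disturb it, because
-- they are not free in the conclusion.

module SyntaxProperties (S : Signature) where
  open Signature S
  open Syntax S

  -- Laws of substitution, free variables and set equality of sequents.

  mutual
    bindT-cong : ∀ {A B : Set} {σ τ : A → Term B} → (∀ x → σ x ≡ τ x) → ∀ t → bindT σ t ≡ bindT τ t
    bindT-cong e (var x)   = e x
    bindT-cong e (fn f ts) = cong (fn f) (bindV-cong e ts)

    bindV-cong : ∀ {A B : Set} {σ τ : A → Term B} → (∀ x → σ x ≡ τ x) →
                 ∀ {n} (ts : Vec (Term A) n) → bindV σ ts ≡ bindV τ ts
    bindV-cong e []       = refl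
    bindV-cong e (t ∷ ts) = cong₂ _∷_ (bindT-cong e t) (bindV-cong e ts)

  mutual
    bindT-bindT : ∀ {A B C : Set} (τ : B → Term C) (σ : A → Term B) t →
                  bindT τ (bindT σ t) ≡ bindT (bindT τ ∘ σ) t
    bindT-bindT τ σ (var x)   = refl
    bindT-bindT τ σ (fn f ts) = cong (fn f) (bindV-bindV τ σ ts)

    bindV-bindV : ∀ {A B C : Set} (τ : B → Term C) (σ : A → Term B) {n} (ts : Vec (Term A) n) →
                  bindV τ (bindV σ ts) ≡ bindV (bindT τ ∘ σ) ts
    bindV-bindV τ σ []       = refl
    bindV-bindV τ σ (t ∷ ts) = cong₂ _∷_ (bindT-bindT τ σ t) (bindV-bindV τ σ ts)

  mutual
    bindT-var : ∀ {A : Set} (t : Term A) → bindT var t ≡ t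
    bindT-var (var x)   = refl
    bindT-var (fn f ts) = cong (fn f) (bindV-var ts)

    bindV-var : ∀ {A : Set} {n} (ts : Vec (Term A) n) → bindV var ts ≡ ts
    bindV-var []       = refl
    bindV-var (t ∷ ts) = cong₂ _∷_ (bindT-var t) (bindV-var ts)

  mutual
    bindT-local : ∀ {σ τ : ℕ → Term ℕ} t → (∀ x → FreeT x t → σ x ≡ τ x) → bindT σ t ≡ bindT τ t
    bindT-local (var x)   e = e x refl
    bindT-local (fn f ts) e = cong (fn f) (bindV-local ts e)

    bindV-local : ∀ {σ τ : ℕ → Term ℕ} {n} (ts : Vec (Term ℕ) n) →
                  (∀ x → FreeV x ts → σ x ≡ τ x) → bindV σ ts ≡ bindV τ ts
    bindV-local []       e = refl
    bindV-local (t ∷ ts) e =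
      cong₂ _∷_ (bindT-local t (λ x → e x ∘ inj₁)) (bindV-local ts (λ x → e x ∘ inj₂))

  ⇑-local : ∀ {σ τ : ℕ → Term ℕ} {P : ℕ → Set} → (∀ x → P (suc x) → σ x ≡ τ x) →
            ∀ x → P x → ⇑ σ x ≡ ⇑ τ x
  ⇑-local e zero    _ = refl
  ⇑-local e (suc x) p = cong (bindT (λ m → var (suc m))) (e x p)

  substF-local : ∀ {σ τ} φ → (∀ x → FreeF x φ → σ x ≡ τ x) → substF σ φ ≡ substF τ φ
  substF-local (ind p ts) e = cong (ind p) (bindV-local ts e)
  substF-local (ord q ts) e = cong (ord q) (bindV-local ts e)
  substF-local (t ≐ u)    e = cong₂ _≐_ (bindT-local t (λ x → e x ∘ inj₁)) (bindT-local u (λ x → e x ∘ inj₂))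
  substF-local (¬' φ)     e = cong ¬' (substF-local φ e)
  substF-local (φ ∨' ψ)   e = cong₂ _∨'_ (substF-local φ (λ x → e x ∘ inj₁)) (substF-local ψ (λ x → e x ∘ inj₂))
  substF-local (φ ∧' ψ)   e = cong₂ _∧'_ (substF-local φ (λ x → e x ∘ inj₁)) (substF-local ψ (λ x → e x ∘ inj₂))
  substF-local (φ ⇒' ψ)   e = cong₂ _⇒'_ (substF-local φ (λ x → e x ∘ inj₁)) (substF-local ψ (λ x → e x ∘ inj₂))
  substF-local (∃' φ)     e = cong ∃' (substF-local φ (⇑-local e))
  substF-local (∀' φ)     e = cong ∀' (substF-local φ (⇑-local e))

  substF-cong : ∀ {σ τ} → (∀ x → σ x ≡ τ x) → ∀ φ → substF σ φ ≡ substF τ φ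
  substF-cong e φ = substF-local φ (λ x _ → e x)

  ⇑-bindT : ∀ (τ σ : ℕ → Term ℕ) x → bindT (⇑ τ) (⇑ σ x) ≡ ⇑ (bindT τ ∘ σ) x
  ⇑-bindT τ σ zero    = refl
  ⇑-bindT τ σ (suc x) = trans (bindT-bindT (⇑ τ) _ (σ x)) (sym (bindT-bindT _ τ (σ x)))

  substF-substF : ∀ τ σ φ → substF τ (substF σ φ) ≡ substF (bindT τ ∘ σ) φ
  substF-substF τ σ (ind p ts) = cong (ind p) (bindV-bindV τ σ ts)
  substF-substF τ σ (ord q ts) = cong (ord q) (bindV-bindV τ σ ts)
  substF-substF τ σ (t ≐ u)    = cong₂ _≐_ (bindT-bindT τ σ t) (bindT-bindT τ σ u)
  substF-substF τ σ (¬' φ)     = cong ¬' (substF-substF τ σ φ)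
  substF-substF τ σ (φ ∨' ψ)   = cong₂ _∨'_ (substF-substF τ σ φ) (substF-substF τ σ ψ)
  substF-substF τ σ (φ ∧' ψ)   = cong₂ _∧'_ (substF-substF τ σ φ) (substF-substF τ σ ψ)
  substF-substF τ σ (φ ⇒' ψ)   = cong₂ _⇒'_ (substF-substF τ σ φ) (substF-substF τ σ ψ)
  substF-substF τ σ (∃' φ)     =
    cong ∃' (trans (substF-substF (⇑ τ) (⇑ σ) φ) (substF-cong (⇑-bindT τ σ) φ))
  substF-substF τ σ (∀' φ)     =
    cong ∀' (trans (substF-substF (⇑ τ) (⇑ σ) φ) (substF-cong (⇑-bindT τ σ) φ))

  ⇑-var : ∀ x → ⇑ var x ≡ var x
  ⇑-var zero    = refl
  ⇑-var (suc x) = refl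

  substF-var : ∀ φ → substF var φ ≡ φ
  substF-var (ind p ts) = cong (ind p) (bindV-var ts)
  substF-var (ord q ts) = cong (ord q) (bindV-var ts)
  substF-var (t ≐ u)    = cong₂ _≐_ (bindT-var t) (bindT-var u)
  substF-var (¬' φ)     = cong ¬' (substF-var φ)
  substF-var (φ ∨' ψ)   = cong₂ _∨'_ (substF-var φ) (substF-var ψ)
  substF-var (φ ∧' ψ)   = cong₂ _∧'_ (substF-var φ) (substF-var ψ)
  substF-var (φ ⇒' ψ)   = cong₂ _⇒'_ (substF-var φ) (substF-var ψ)
  substF-var (∃' φ)     = cong ∃' (trans (substF-cong ⇑-var φ) (substF-var φ))
  substF-var (∀' φ)     = cong ∀' (trans (substF-cong ⇑-var φ) (substF-var φ))

  substF-inst : ∀ σ φ t → substF σ (φ [ t ]₀) ≡ (substF (⇑ σ) φ) [ bindT σ t ]₀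
  substF-inst σ φ t =
    trans (substF-substF σ _ φ)
          (trans (substF-cong pointwise φ) (sym (substF-substF _ (⇑ σ) φ)))
    where
    pointwise : ∀ x → _ ≡ _
    pointwise zero    = refl
    pointwise (suc x) = sym (trans (bindT-bindT _ _ (σ x)) (bindT-var (σ x)))

  -- Meant for eigenvariables: `τ` renames the eigenvariable and agrees with `σ` on the free
  -- variables of the quantified formula.
  substF-inst-local : ∀ σ τ φ t → (∀ x → FreeF (suc x) φ → τ x ≡ σ x) →
                      substF τ (φ [ t ]₀) ≡ (substF (⇑ σ) φ) [ bindT τ t ]₀
  substF-inst-local σ τ φ t e =
    trans (substF-inst τ φ t) (cong (_[ bindT τ t ]₀) (substF-local φ (⇑-local e)))

  -- Freshness is demanded for the whole image, so that it holds for every instantiated formula at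
  -- once, whatever its free variables.
  Avoids : ℕ → (ℕ → Term ℕ) → Set
  Avoids y σ = ∀ x → ¬ FreeT y (σ x)

  mutual
    avoids-bindT : ∀ {y σ} → Avoids y σ → ∀ t → ¬ FreeT y (bindT σ t)
    avoids-bindT a (var x)   = a x
    avoids-bindT a (fn f ts) = avoids-bindV a ts

    avoids-bindV : ∀ {y σ} → Avoids y σ → ∀ {n} (ts : Vec (Term ℕ) n) → ¬ FreeV y (bindV σ ts)
    avoids-bindV a (t ∷ ts) (inj₁ f) = avoids-bindT a t f
    avoids-bindV a (t ∷ ts) (inj₂ f) = avoids-bindV a ts f

  mutual
    freeT-suc : ∀ {y} t → FreeT (suc y) (bindT (λ m → var (suc m)) t) → FreeT y t
    freeT-suc (var x)   f = suc-injective f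
    freeT-suc (fn _ ts) f = freeV-suc ts f

    freeV-suc : ∀ {y n} (ts : Vec (Term ℕ) n) → FreeV (suc y) (bindV (λ m → var (suc m)) ts) → FreeV y ts
    freeV-suc (t ∷ ts) (inj₁ f) = inj₁ (freeT-suc t f)
    freeV-suc (t ∷ ts) (inj₂ f) = inj₂ (freeV-suc ts f)

  avoids-⇑ : ∀ {y σ} → Avoids y σ → Avoids (suc y) (⇑ σ)
  avoids-⇑ a zero    ()
  avoids-⇑ {σ = σ} a (suc x) f = a x (freeT-suc (σ x) f)

  avoids-substF : ∀ {y σ} → Avoids y σ → ∀ φ → ¬ FreeF y (substF σ φ)
  avoids-substF a (ind p ts) f        = avoids-bindV a ts f
  avoids-substF a (ord q ts) f        = avoids-bindV a ts f
  avoids-substF a (t ≐ u)    (inj₁ f) = avoids-bindT a t f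
  avoids-substF a (t ≐ u)    (inj₂ f) = avoids-bindT a u f
  avoids-substF a (¬' φ)     f        = avoids-substF a φ f
  avoids-substF a (φ ∨' ψ)   (inj₁ f) = avoids-substF a φ f
  avoids-substF a (φ ∨' ψ)   (inj₂ f) = avoids-substF a ψ f
  avoids-substF a (φ ∧' ψ)   (inj₁ f) = avoids-substF a φ f
  avoids-substF a (φ ∧' ψ)   (inj₂ f) = avoids-substF a ψ f
  avoids-substF a (φ ⇒' ψ)   (inj₁ f) = avoids-substF a φ f
  avoids-substF a (φ ⇒' ψ)   (inj₂ f) = avoids-substF a ψ f
  avoids-substF a (∃' φ)     f        = avoids-substF (avoids-⇑ a) φ f
  avoids-substF a (∀' φ)     f        = avoids-substF (avoids-⇑ a) φ f

  avoids-map : ∀ {y σ} → Avoids y σ → ∀ Γ → ¬ FreeIn y (map (substF σ) Γ)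
  avoids-map a Γ (φ , φ∈ , f) with ∈-map⁻ (substF _) φ∈
  ... | ψ , _ , refl = avoids-substF a ψ f

  mutual
    boundT : Term ℕ → ℕ
    boundT (var x)   = suc x
    boundT (fn f ts) = boundV ts

    boundV : ∀ {n} → Vec (Term ℕ) n → ℕ
    boundV []       = 0
    boundV (t ∷ ts) = boundT t ⊔ boundV ts

  boundF : Formula → ℕ
  boundF (ind p ts) = boundV ts
  boundF (ord q ts) = boundV ts
  boundF (t ≐ u)    = boundT t ⊔ boundT u
  boundF (¬' φ)     = boundF φ
  boundF (φ ∨' ψ)   = boundF φ ⊔ boundF ψ
  boundF (φ ∧' ψ)   = boundF φ ⊔ boundF ψ
  boundF (φ ⇒' ψ)   = boundF φ ⊔ boundF ψ
  boundF (∃' φ)     = pred (boundF φ)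
  boundF (∀' φ)     = pred (boundF φ)

  boundL : List Formula → ℕ
  boundL []      = 0
  boundL (φ ∷ Γ) = boundF φ ⊔ boundL Γ

  boundS : Sequent → ℕ
  boundS s = boundL (ante s) ⊔ boundL (succ s)

  <-⊔ : ∀ {x m n} → (x < m) ⊎ (x < n) → x < m ⊔ n
  <-⊔ {m = m} {n} (inj₁ l) = ≤-trans l (m≤m⊔n m n)
  <-⊔ {m = m} {n} (inj₂ l) = ≤-trans l (m≤n⊔m m n)

  <-pred : ∀ {x n} → suc x < n → x < pred n
  <-pred (s≤s l) = l

  mutual
    freeT-< : ∀ {x} t → FreeT x t → x < boundT t
    freeT-< (var x)   refl = s≤s ≤-refl
    freeT-< (fn f ts) p    = freeV-< ts p

    freeV-< : ∀ {x n} (ts : Vec (Term ℕ) n) → FreeV x ts → x < boundV ts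
    freeV-< (t ∷ ts) p = <-⊔ (Sum.map (freeT-< t) (freeV-< ts) p)

  freeF-< : ∀ {x} φ → FreeF x φ → x < boundF φ
  freeF-< (ind _ ts) p = freeV-< ts p
  freeF-< (ord _ ts) p = freeV-< ts p
  freeF-< (t ≐ u)    p = <-⊔ (Sum.map (freeT-< t) (freeT-< u) p)
  freeF-< (¬' φ)     p = freeF-< φ p
  freeF-< (φ ∨' ψ)   p = <-⊔ (Sum.map (freeF-< φ) (freeF-< ψ) p)
  freeF-< (φ ∧' ψ)   p = <-⊔ (Sum.map (freeF-< φ) (freeF-< ψ) p)
  freeF-< (φ ⇒' ψ)   p = <-⊔ (Sum.map (freeF-< φ) (freeF-< ψ) p)
  freeF-< (∃' φ)     p = <-pred (freeF-< φ p)
  freeF-< (∀' φ)     p = <-pred (freeF-< φ p)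

  freeL-< : ∀ {x φ} Γ → φ ∈ Γ → FreeF x φ → x < boundL Γ
  freeL-< (φ ∷ Γ) (here refl) f = <-⊔ (inj₁ (freeF-< φ f))
  freeL-< (φ ∷ Γ) (there m)   f = <-⊔ {m = boundF φ} (inj₂ (freeL-< Γ m f))

  map-local : ∀ {σ τ} Γ → (∀ x → FreeIn x Γ → σ x ≡ τ x) → map (substF σ) Γ ≡ map (substF τ) Γ
  map-local Γ e = map-cong-local (All.tabulate (λ {φ} φ∈ → substF-local φ (λ x f → e x (φ , φ∈ , f))))

  substS : (ℕ → Term ℕ) → Sequent → Sequent
  substS σ s = map (substF σ) (ante s) ⊢ map (substF σ) (succ s)

  substS-bounded : ∀ {σ τ} s → (∀ x → x < boundS s → σ x ≡ τ x) → substS σ s ≡ substS τ s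
  substS-bounded s e = cong₂ _⊢_
    (map-local (ante s) (λ { x (φ , m , f) → e x (<-⊔ (inj₁ (freeL-< (ante s) m f))) }))
    (map-local (succ s) (λ { x (φ , m , f) → e x (<-⊔ {m = boundL (ante s)} (inj₂ (freeL-< (succ s) m f))) }))

  substS-substS : ∀ τ σ s → substS τ (substS σ s) ≡ substS (bindT τ ∘ σ) s
  substS-substS τ σ s = cong₂ _⊢_ (go (ante s)) (go (succ s))
    where
    go : ∀ Γ → map (substF τ) (map (substF σ) Γ) ≡ map (substF (bindT τ ∘ σ)) Γ
    go Γ = trans (sym (map-∘ Γ)) (map-cong-local (All.tabulate (λ {φ} _ → substF-substF τ σ φ)))

  substS-var : ∀ s → substS var s ≡ s
  substS-var s = cong₂ _⊢_ (map-id-local (All.tabulate (λ {φ} _ → substF-var φ)))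
                           (map-id-local (All.tabulate (λ {φ} _ → substF-var φ)))

  map-⊆L : ∀ σ {Γ Δ} → Γ ⊆L Δ → map (substF σ) Γ ⊆L map (substF σ) Δ
  map-⊆L σ i φ φ∈ with ∈-map⁻ (substF σ) φ∈
  ... | ψ , ψ∈ , refl = ∈-map⁺ (substF σ) (i ψ ψ∈)

  substS-≈ : ∀ σ {s s'} → s ≈S s' → substS σ s ≈S substS σ s'
  substS-≈ σ ((a , b) , (c , d)) = (map-⊆L σ a , map-⊆L σ b) , (map-⊆L σ c , map-⊆L σ d)

  ≈S-refl : ∀ {s} → s ≈S s
  ≈S-refl = ((λ _ m → m) , (λ _ m → m)) , ((λ _ m → m) , (λ _ m → m))

  ≈S-reflexive : ∀ {s s'} → s ≡ s' → s ≈S s'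
  ≈S-reflexive refl = ≈S-refl

  ≈S-sym : ∀ {s s'} → s ≈S s' → s' ≈S s
  ≈S-sym ((a , b) , (c , d)) = (b , a) , (d , c)

  ≈S-trans : ∀ {s s' s''} → s ≈S s' → s' ≈S s'' → s ≈S s''
  ≈S-trans ((a , b) , (c , d)) ((a' , b') , (c' , d')) =
    ((λ φ → a' φ ∘ a φ) , (λ φ → b φ ∘ b' φ)) , ((λ φ → c' φ ∘ c φ) , (λ φ → d φ ∘ d' φ))

  isIndAtom-substF : ∀ σ φ → IsIndAtom φ → IsIndAtom (substF σ φ)
  isIndAtom-substF σ (ind _ _) _ = _

-- Concatenation of finite paths into an infinite one, and regrouping of its traces.

module Paths (A F : Set) (E : A → A → Set) (St : A → A → F → F → Bool → Set) (OK : A → F → Set) where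

  infixr 5 _∷_
  data Path : A → A → Set where
    nil : ∀ {x} → Path x x
    _∷_ : ∀ {x y z} → E x y → Path y z → Path x z

  NonEmpty : ∀ {x y} → Path x y → Set
  NonEmpty nil     = ⊥
  NonEmpty (_ ∷ _) = ⊤

  -- `OK` is recorded at every vertex including the last, so that even an empty path certifies an
  -- admissible occurrence at its end point.
  data Trace : ∀ {x y} → Path x y → F → F → Bool → Set where
    nil : ∀ {x C} → OK x C → Trace (nil {x}) C C false
    _∷_ : ∀ {x y z C C' D b b'} {e : E x y} {p : Path y z} → OK x C × St x y C C' b → Trace p C' D b' →
          Trace (e ∷ p) C D (b ∨ b')

  HasTrace : (ℕ → A) → Set
  HasTrace s = Σ ℕ λ k₀ → Σ (ℕ → F) λ C → Σ (ℕ → Bool) λ prog →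
    (∀ k → k₀ ≤ k → OK (s k) (C k) × St (s k) (s (suc k)) (C k) (C (suc k)) (prog k))
    × (∀ m → Σ ℕ λ k → m ≤ k × k₀ ≤ k × prog k ≡ true)

  HasPathTrace : (a : ℕ → A) → (∀ k → Path (a k) (a (suc k))) → Set
  HasPathTrace a π = Σ ℕ λ k₀ → Σ (ℕ → F) λ C → Σ (ℕ → Bool) λ prog →
    (∀ k → k₀ ≤ k → Trace (π k) (C k) (C (suc k)) (prog k))
    × (∀ m → Σ ℕ λ k → m ≤ k × k₀ ≤ k × prog k ≡ true)

  -- Single segments may be empty, but of two consecutive ones at least one contributes an edge.
  -- This makes the concatenation infinite and lets the next edge be found by looking at most one
  -- segment ahead.
  module Flatten (a : ℕ → A) (π : ∀ k → Path (a k) (a (suc k)))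
                 (ne : ∀ k → NonEmpty (π k) ⊎ NonEmpty (π (suc k))) where

    record Next (x : A) : Set where
      constructor next
      field
        {y}  : A
        edge : E x y
        n    : ℕ
        rest : Path y (a (suc n))

    first : ∀ n {x} (p : Path x (a (suc n))) → NonEmpty p → Next x
    first n (e ∷ p) _ = next e n p

    first₂ : ∀ n {x} (p : Path x (a (suc n))) → NonEmpty p ⊎ NonEmpty (π (suc n)) → Next x
    first₂ n (e ∷ p) _        = next e n p
    first₂ n nil     (inj₂ h) = first (suc n) (π (suc n)) h

    start : ∀ n → Next (a n)
    start n = first₂ n (π n) (ne n)

    -- The m-th vertex of the concatenation of p with π (suc n), π (suc (suc n)), …
    vert : ∀ n {x} → Path x (a (suc n)) → ℕ → A
    vert n {x} p       zero    = x
    vert n     (e ∷ p) (suc m) = vert n p m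
    vert n     nil     (suc m) = vert (Next.n (start (suc n))) (Next.rest (start (suc n))) m

    vert-edge : ∀ n {x} (p : Path x (a (suc n))) m → E (vert n p m) (vert n p (suc m))
    vert-edge n (e ∷ p) zero    = e
    vert-edge n (e ∷ p) (suc m) = vert-edge n p m
    vert-edge n nil     zero    = Next.edge (start (suc n))
    vert-edge n nil     (suc m) = vert-edge (Next.n (start (suc n))) (Next.rest (start (suc n))) m

    first-first₂ : ∀ n {x} (p : Path x (a (suc n))) h h' → first n p h ≡ first₂ n p h'
    first-first₂ n (e ∷ p) h h' = refl

    vert-first₂ : ∀ n {x} (p : Path x (a (suc n))) h m →
                  vert (Next.n (first₂ n p h)) (Next.rest (first₂ n p h)) m ≡ vert n p (suc m)
    vert-first₂ n (e ∷ p) h        m = refl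
    vert-first₂ n nil     (inj₂ h) m =
      cong (λ s → vert (Next.n s) (Next.rest s) m) (first-first₂ (suc n) (π (suc n)) h (ne (suc n)))

    vert-nil : ∀ n m → vert n nil m ≡ vert (suc n) (π (suc n)) m
    vert-nil n zero    = refl
    vert-nil n (suc m) = vert-first₂ (suc n) (π (suc n)) (ne (suc n)) m

    flat : ℕ → A
    flat = vert 0 (π 0)

    -- The place in `flat` where a segment starting at `d` ends. The accumulator form keeps it in
    -- step, definitionally, with recursion along the segment.
    adv : ∀ {x y} → Path x y → ℕ → ℕ
    adv nil     d = d
    adv (_ ∷ p) d = adv p (suc d)

    offset : ℕ → ℕ
    offset zero    = 0
    offset (suc k) = adv (π k) (offset k)

    FlatFrom : ∀ n {x} → Path x (a (suc n)) → ℕ → Set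
    FlatFrom n p d = ∀ j → flat (d + j) ≡ vert n p j

    flatFrom-tail : ∀ n {x y} {e : E x y} {p : Path y (a (suc n))} {d} → FlatFrom n (e ∷ p) d → FlatFrom n p (suc d)
    flatFrom-tail n {d = d} h j = trans (cong flat (sym (+-suc d j))) (h (suc j))

    flatFrom-adv : ∀ n {x} (p : Path x (a (suc n))) {d} → FlatFrom n p d → FlatFrom n nil (adv p d)
    flatFrom-adv n nil         h = h
    flatFrom-adv n (e ∷ p) {d} h = flatFrom-adv n p (flatFrom-tail n {e = e} {p} {d} h)

    flatFrom-offset : ∀ k → FlatFrom k (π k) (offset k)
    flatFrom-offset zero    j = refl
    flatFrom-offset (suc k) j = trans (flatFrom-adv k (π k) (flatFrom-offset k) j) (vert-nil k j)

    adv-≤ : ∀ {x y} (p : Path x y) d → d ≤ adv p d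
    adv-≤ nil     d = ≤-refl
    adv-≤ (_ ∷ p) d = ≤-trans (n≤1+n d) (adv-≤ p (suc d))

    adv-< : ∀ {x y} (p : Path x y) → NonEmpty p → ∀ d → d < adv p d
    adv-< (_ ∷ p) _ d = adv-≤ p (suc d)

    offset-grows : ∀ k → offset k < offset (suc (suc k))
    offset-grows k with ne k
    ... | inj₁ h = ≤-trans (adv-< (π k) h _) (adv-≤ (π (suc k)) _)
    ... | inj₂ h = ≤-trans (s≤s (adv-≤ (π k) _)) (adv-< (π (suc k)) h _)

    offset-unbounded : ∀ n → ∃ λ k → n ≤ offset k
    offset-unbounded zero    = 0 , z≤n
    offset-unbounded (suc n) with offset-unbounded n
    ... | k , l = suc (suc k) , ≤-trans (s≤s l) (offset-grows k)

    offset-mono : ∀ k j → offset k ≤ offset (k + j)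
    offset-mono k zero    = ≤-reflexive (cong offset (sym (+-identityʳ k)))
    offset-mono k (suc j) = ≤-trans (offset-mono k j)
      (≤-trans (adv-≤ (π (k + j)) _) (≤-reflexive (cong offset (sym (+-suc k j)))))

    module _ (gtc : HasTrace flat) where
      k₀ = proj₁ gtc
      C = proj₁ (proj₂ gtc)
      prog = proj₁ (proj₂ (proj₂ gtc))
      isTrace = proj₁ (proj₂ (proj₂ (proj₂ gtc)))
      infProg = proj₂ (proj₂ (proj₂ (proj₂ gtc)))

      anyProg : ∀ {x y} → Path x y → ℕ → Bool
      anyProg nil     d = false
      anyProg (_ ∷ p) d = prog d ∨ anyProg p (suc d)

      traceAt : ∀ n {x} (p : Path x (a (suc n))) d → k₀ ≤ d → FlatFrom n p d →
                Trace p (C d) (C (adv p d)) (anyProg p d)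
      traceAt n {x} nil d l h = nil (≡.subst (λ z → OK z (C d)) (trans (cong flat (sym (+-identityʳ d))) (h 0)) (proj₁ (isTrace d l)))
      traceAt n {x} (_∷_ {y = y} e p) d l h =
        (≡.subst (λ z → OK z (C d)) eq₀ (proj₁ (isTrace d l)) ,
         ≡.subst₂ (λ z z' → St z z' (C d) (C (suc d)) (prog d)) eq₀ eq₁ (proj₂ (isTrace d l)))
        ∷ traceAt n p (suc d) (≤-trans l (n≤1+n d)) h'
        where
        h' : FlatFrom n p (suc d)
        h' = flatFrom-tail n {e = e} {p} {d} h
        eq₀ : flat d ≡ x
        eq₀ = trans (cong flat (sym (+-identityʳ d))) (h 0)
        eq₁ : flat (suc d) ≡ y
        eq₁ = trans (cong flat (sym (+-identityʳ (suc d)))) (h' 0)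

      Later : ∀ {x y} → Path x y → ℕ → ℕ → Set
      Later p d j = ∃ λ j' → prog (adv p d + j') ≡ true × j' ≤ j × (NonEmpty p → j' < j)

      scan : ∀ {x y} (p : Path x y) d j → prog (d + j) ≡ true → (anyProg p d ≡ true) ⊎ Later p d j
      scan nil     d j       e = inj₂ (j , e , ≤-refl , λ ())
      scan (_ ∷ p) d zero    e = inj₁ (cong (_∨ anyProg p (suc d)) (trans (cong prog (sym (+-identityʳ d))) e))
      scan (_ ∷ p) d (suc j) e with scan p (suc d) j (trans (cong prog (sym (+-suc d j))) e)
      ... | inj₁ t                = inj₁ (trans (cong (prog d ∨_) t) (∨-zeroʳ (prog d)))
      ... | inj₂ (j' , e' , l , _) = inj₂ (j' , e' , ≤-trans l (n≤1+n j) , λ _ → s≤s l)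

      -- The measure is the distance `j` from the start of segment `k` to the progressing point:
      -- passing two consecutive segments shortens it, since one of them has an edge.
      locate : ∀ fuel k j → j < fuel → prog (offset k + j) ≡ true →
               ∃ λ k' → k ≤ k' × anyProg (π k') (offset k') ≡ true
      locate (suc f) k j (s≤s j≤f) e with scan (π k) (offset k) j e
      ... | inj₁ t = k , ≤-refl , t
      ... | inj₂ (j' , e' , l' , s') with scan (π (suc k)) (offset (suc k)) j' e'
      ...   | inj₁ t = suc k , n≤1+n k , t
      ...   | inj₂ (j'' , e'' , l'' , s'') with locate f (suc (suc k)) j'' (≤-trans (shrink (ne k)) j≤f) e''
        where
        shrink : NonEmpty (π k) ⊎ NonEmpty (π (suc k)) → j'' < j
        shrink (inj₁ h) = ≤-trans (s≤s l'') (s' h)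
        shrink (inj₂ h) = ≤-trans (s'' h) l'
      ...     | k' , l , t = k' , ≤-trans (≤-trans (n≤1+n k) (n≤1+n (suc k))) l , t

      hasPathTrace : HasPathTrace a π
      hasPathTrace = k₁ , (λ k → C (offset k)) , (λ k → anyProg (π k) (offset k)) ,
        (λ k l → traceAt k (π k) (offset k) (late k l) (flatFrom-offset k)) , inf
        where
        k₁ = proj₁ (offset-unbounded k₀)
        late : ∀ k → k₁ ≤ k → k₀ ≤ offset k
        late k l with m≤n⇒∃[o]m+o≡n l
        ... | j , refl = ≤-trans (proj₂ (offset-unbounded k₀)) (offset-mono k₁ j)
        inf : ∀ m → Σ ℕ λ k → m ≤ k × k₁ ≤ k × anyProg (π k) (offset k) ≡ true
        -- Searching from the start of segment `m ⊔ k₁` places the segment found beyond `m` and in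
        -- the range where traces exist.
        inf m with infProg (offset (m ⊔ k₁))
        ... | l , o≤l , _ , t with m≤n⇒∃[o]m+o≡n o≤l
        ...   | j , refl with locate (suc j) (m ⊔ k₁) j ≤-refl t
        ...     | k , le , t' = k , ≤-trans (m≤m⊔n m k₁) le , ≤-trans (m≤n⊔m m k₁) le , t'

-- Pushing a substitution through a rule.

≡ᵇ-refl : ∀ n → (n ≡ᵇ n) ≡ true
≡ᵇ-refl zero    = refl
≡ᵇ-refl (suc n) = ≡ᵇ-refl n

≢⇒≡ᵇ-false : ∀ {m n} → m ≢ n → (m ≡ᵇ n) ≡ false
≢⇒≡ᵇ-false {m} {n} m≢n with m ≡ᵇ n in eq
... | false = refl
... | true  = ⊥-elim (m≢n (≡ᵇ⇒≡ m n (≡.subst T (sym eq) tt)))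

unmapIx : ∀ {A B : Set} (f : A → B) xs → Fin (length (map f xs)) → Fin (length xs)
unmapIx f (x ∷ xs) Fin.zero    = Fin.zero
unmapIx f (x ∷ xs) (Fin.suc i) = Fin.suc (unmapIx f xs i)

lookup-unmapIx : ∀ {A B : Set} (f : A → B) xs i → lookup (map f xs) i ≡ f (lookup xs (unmapIx f xs i))
lookup-unmapIx f (x ∷ xs) Fin.zero    = refl
lookup-unmapIx f (x ∷ xs) (Fin.suc i) = lookup-unmapIx f xs i

lookup-subst : ∀ {A : Set} {xs ys : List A} (e : xs ≡ ys) i →
               lookup xs i ≡ lookup ys (≡.subst (Fin ∘ length) e i)
lookup-subst refl i = refl

data Code (K : Set) : Set where
  v : ℕ → Code K
  c : K → Code K

module Interpretation (S : Signature) (K : Set) (kon : K → Syntax.Term S ℕ) where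
  open Syntax S

  ⟦_⟧c : Code K → Term ℕ
  ⟦ v n ⟧c = var n
  ⟦ c k ⟧c = kon k

module RuleTranslation (S : Signature) (Φ : List (Syntax.Production S)) (K : Set) (kon : K → Syntax.Term S ℕ) where
  open Signature S
  open Syntax S
  open SyntaxProperties S
  open Calculus S Φ
  open Interpretation S K kon

  record Env : Set where
    field
      σ      : ℕ → Code K
      fr     : ℕ → ℕ
      fr-inj : Injective _≡_ _≡_ fr
      fr-av  : ∀ n → Avoids (fr n) (⟦_⟧c ∘ σ)

    σt : ℕ → Term ℕ
    σt = ⟦_⟧c ∘ σ

    rename : ∀ {k} → (Fin k → ℕ) → ℕ → Code K
    rename ys x with any? (λ i → ys i ≟ x)
    ... | yes (i , _) = v (fr (toℕ i))
    ... | no _        = σ x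

    rename-∈ : ∀ {k} {ys : Fin k → ℕ} → Injective _≡_ _≡_ ys → ∀ i → rename ys (ys i) ≡ v (fr (toℕ i))
    rename-∈ {ys = ys} inj i with any? (λ j → ys j ≟ ys i)
    ... | yes (j , e) = cong (v ∘ fr ∘ toℕ) (inj e)
    ... | no ¬e       = ⊥-elim (¬e (i , refl))

    rename-∉ : ∀ {k} {ys : Fin k → ℕ} {x} → (∀ i → ys i ≢ x) → rename ys x ≡ σ x
    rename-∉ {ys = ys} {x} ≢ with any? (λ j → ys j ≟ x)
    ... | yes (j , e) = ⊥-elim (≢ j e)
    ... | no _        = refl

    rename-all : ∀ {k} (ys : Fin k → ℕ) (P : Code K → Set) → (∀ x → P (σ x)) →
                 (∀ n → n < k → P (v (fr n))) → ∀ x → P (rename ys x)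
    rename-all ys P pσ pfr x with any? (λ j → ys j ≟ x)
    ... | yes (j , _) = pfr (toℕ j) (toℕ<n j)
    ... | no _        = pσ x

    -- The variables x, y of (= L) only mark places in Γ and Δ and may clash with the image of σ, so
    -- they are renamed to fr 0, fr 1.
    eqσ : ℕ → ℕ → ℕ → Term ℕ
    eqσ x y z = if z ≡ᵇ x then var (fr 0) else (if z ≡ᵇ y then var (fr 1) else σt z)

    bindT-fresh-id : ∀ t u s → (∀ x → FreeT x s → x ≢ fr 0 × x ≢ fr 1) →
                     bindT (t / fr 0 , u / fr 1) s ≡ s
    bindT-fresh-id t u s fresh = trans (bindT-local s go) (bindT-var s)
      where
      go : ∀ x → FreeT x s → (t / fr 0 , u / fr 1) x ≡ var x
      go x f rewrite ≢⇒≡ᵇ-false (proj₁ (fresh x f)) | ≢⇒≡ᵇ-false (proj₂ (fresh x f)) = refl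

    -- `eqσ` mentions neither `t` nor `u`, so the same marked contexts serve the conclusion and,
    -- with `t` and `u` exchanged, the premise. For an unmarked `z` the outer substitution acts on
    -- `σt z`, in which the markers do not occur.
    eqσ-commutes : ∀ x y t u z → bindT (bindT σt t / fr 0 , bindT σt u / fr 1) (eqσ x y z)
                                 ≡ bindT σt ((t / x , u / y) z)
    eqσ-commutes x y t u z with z ≡ᵇ x
    ... | true rewrite ≡ᵇ-refl (fr 0) = refl
    ... | false with z ≡ᵇ y
    ...   | false = bindT-fresh-id _ _ (σt z) (λ w f → (λ { refl → fr-av 0 z f }) , (λ { refl → fr-av 1 z f }))
    ...   | true rewrite ≢⇒≡ᵇ-false {fr 1} {fr 0} (λ e → 1+n≢0 (fr-inj e)) | ≡ᵇ-refl (fr 1) = refl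

    substF-eqσ : ∀ x y t u φ → substF (bindT σt t / fr 0 , bindT σt u / fr 1) (substF (eqσ x y) φ)
                               ≡ substF σt (substF (t / x , u / y) φ)
    substF-eqσ x y t u φ = trans (substF-substF _ _ φ)
      (trans (substF-cong (eqσ-commutes x y t u) φ) (sym (substF-substF _ _ φ)))

    map-eqσ : ∀ x y t u Γ → map (substF (bindT σt t / fr 0 , bindT σt u / fr 1)) (map (substF (eqσ x y)) Γ)
                            ≡ map (substF σt) (map (substF (t / x , u / y)) Γ)
    map-eqσ x y t u Γ = trans (sym (map-∘ Γ)) (trans (map-cong (substF-eqσ x y t u) Γ) (map-∘ Γ))

    substCode : (ℕ → K) → ℕ → Term ℕ → Code K
    substCode key x (var z)  = σ z
    substCode key x (fn _ _) = c (key x)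

    tr : Rule → Rule
    tr (axiom Γ Δ (φ , a , b)) =
      axiom (map (substF σt) Γ) (map (substF σt) Δ) (substF σt φ , ∈-map⁺ _ a , ∈-map⁺ _ b)
    tr (eqR Γ Δ t) = eqR (map (substF σt) Γ) (map (substF σt) Δ) (bindT σt t)
    tr (wk Γ Δ Γ' Δ' i j) = wk (map (substF σt) Γ) (map (substF σt) Δ) (map (substF σt) Γ') (map (substF σt) Δ')
                               (map-⊆L σt i) (map-⊆L σt j)
    tr (cut Γ Δ φ) = cut (map (substF σt) Γ) (map (substF σt) Δ) (substF σt φ)
    -- A placeholder: the lemmas on conclusions, premises and trace correspondence exclude this case
    -- by `name r ≢ Subst`.
    tr (subst θ Γ Δ) = subst θ Γ Δ
    tr (negL Γ Δ φ) = negL (map (substF σt) Γ) (map (substF σt) Δ) (substF σt φ)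
    tr (negR Γ Δ φ) = negR (map (substF σt) Γ) (map (substF σt) Δ) (substF σt φ)
    tr (orL Γ Δ φ ψ) = orL (map (substF σt) Γ) (map (substF σt) Δ) (substF σt φ) (substF σt ψ)
    tr (orR Γ Δ φ ψ) = orR (map (substF σt) Γ) (map (substF σt) Δ) (substF σt φ) (substF σt ψ)
    tr (andL Γ Δ φ ψ) = andL (map (substF σt) Γ) (map (substF σt) Δ) (substF σt φ) (substF σt ψ)
    tr (andR Γ Δ φ ψ) = andR (map (substF σt) Γ) (map (substF σt) Δ) (substF σt φ) (substF σt ψ)
    tr (impL Γ Δ φ ψ) = impL (map (substF σt) Γ) (map (substF σt) Δ) (substF σt φ) (substF σt ψ)
    tr (impR Γ Δ φ ψ) = impR (map (substF σt) Γ) (map (substF σt) Δ) (substF σt φ) (substF σt ψ)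
    tr (allL Γ Δ φ t) = allL (map (substF σt) Γ) (map (substF σt) Δ) (substF (⇑ σt) φ) (bindT σt t)
    tr (exR Γ Δ φ t) = exR (map (substF σt) Γ) (map (substF σt) Δ) (substF (⇑ σt) φ) (bindT σt t)
    tr (allR Γ Δ φ y _) = allR (map (substF σt) Γ) (map (substF σt) Δ) (substF (⇑ σt) φ) (fr 0)
      (≡.subst (λ A → ¬ FreeIn (fr 0) A) (map-++ _ Γ (∀' φ ∷ Δ)) (avoids-map (fr-av 0) (Γ ++ ∀' φ ∷ Δ)))
    tr (exL Γ Δ φ y _) = exL (map (substF σt) Γ) (map (substF σt) Δ) (substF (⇑ σt) φ) (fr 0)
      (≡.subst (λ A → ¬ FreeIn (fr 0) A) (map-++ _ (∃' φ ∷ Γ) Δ) (avoids-map (fr-av 0) (∃' φ ∷ Γ ++ Δ)))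
    tr (eqL Γ Δ x y t u) =
      eqL (map (substF (eqσ x y)) Γ) (map (substF (eqσ x y)) Δ) (fr 0) (fr 1) (bindT σt t) (bindT σt u)
    tr (unfoldL Γ Δ p us ys _ _) =
      unfoldL (map (substF σt) Γ) (map (substF σt) Δ) p (bindV σt us) (λ _ i → fr (toℕ i))
              (λ _ e → toℕ-injective (fr-inj e))
              (λ _ i → ≡.subst (λ A → ¬ FreeIn (fr (toℕ i)) A) (map-++ _ (ind p us ∷ Γ) Δ)
                               (avoids-map (fr-av (toℕ i)) (ind p us ∷ Γ ++ Δ)))
    tr (unfoldR Γ Δ j us) = unfoldR (map (substF σt) Γ) (map (substF σt) Δ) j (bindT σt ∘ us)

    tr-name : ∀ r → name (tr r) ≡ name r
    tr-name (axiom _ _ _) = refl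
    tr-name (eqR _ _ _) = refl
    tr-name (wk _ _ _ _ _ _) = refl
    tr-name (cut _ _ _) = refl
    tr-name (subst _ _ _) = refl
    tr-name (negL _ _ _) = refl
    tr-name (negR _ _ _) = refl
    tr-name (orL _ _ _ _) = refl
    tr-name (orR _ _ _ _) = refl
    tr-name (andL _ _ _ _) = refl
    tr-name (andR _ _ _ _) = refl
    tr-name (impL _ _ _ _) = refl
    tr-name (impR _ _ _ _) = refl
    tr-name (allL _ _ _ _) = refl
    tr-name (exR _ _ _ _) = refl
    tr-name (allR _ _ _ _ _) = refl
    tr-name (exL _ _ _ _ _) = refl
    tr-name (eqL _ _ _ _ _ _) = refl
    tr-name (unfoldL _ _ _ _ _ _ _) = refl
    tr-name (unfoldR _ _ _ _) = refl

    map-atoms : ∀ {A : Set} {ar : A → ℕ} {k} {g : (a : A) → Vec (Term ℕ) (ar a) → Formula} ρ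
                (us us' : Fin k → Term ℕ) →
                (∀ i → us' i ≡ bindT ρ (us i)) → (∀ a ts → substF ρ (g a ts) ≡ g a (bindV ρ ts)) →
                ∀ (as : List (Σ A λ a → Vec (Term (Fin k)) (ar a))) →
                map (λ a → g (proj₁ a) (bindV us' (proj₂ a))) as
                ≡ map (substF ρ) (map (λ a → g (proj₁ a) (bindV us (proj₂ a))) as)
    map-atoms {g = g} ρ us us' e h as = trans
      (map-cong (λ a → trans (cong (g (proj₁ a)) (trans (bindV-cong e (proj₂ a)) (sym (bindV-bindV ρ us (proj₂ a)))))
                             (sym (h (proj₁ a) _))) as)
      (map-∘ as)

    map-QAtoms : ∀ pr ρ {us us'} → (∀ i → us' i ≡ bindT ρ (us i)) →
                 QAtoms pr us' ≡ map (substF ρ) (QAtoms pr us)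
    map-QAtoms pr ρ {us} {us'} e = map-atoms {g = ord} ρ us us' e (λ _ _ → refl) (Production.qs pr)

    map-PAtoms : ∀ pr ρ {us us'} → (∀ i → us' i ≡ bindT ρ (us i)) →
                 PAtoms pr us' ≡ map (substF ρ) (PAtoms pr us)
    map-PAtoms pr ρ {us} {us'} e = map-atoms {g = ind} ρ us us' e (λ _ _ → refl) (Production.ps pr)

    zip-≐ : ∀ ρ {m n} (ts : Vec (Term ℕ) m) (us : Vec (Term ℕ) n) →
            zipWith _≐_ (toList (bindV ρ ts)) (toList (bindV ρ us))
            ≡ map (substF ρ) (zipWith _≐_ (toList ts) (toList us))
    zip-≐ ρ []       _        = refl
    zip-≐ ρ (_ ∷ _)  []       = refl
    zip-≐ ρ (_ ∷ ts) (_ ∷ us) = cong (_ ∷_) (zip-≐ ρ ts us)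

    map-HeadEqs : ∀ pr ρ {us us'} → (∀ i → us' i ≡ bindT ρ (us i)) → ∀ {n} (ts : Vec (Term ℕ) n) →
                  HeadEqs pr us' (bindV ρ ts) ≡ map (substF ρ) (HeadEqs pr us ts)
    map-HeadEqs pr ρ {us} e ts = trans
      (cong (λ h → zipWith _≐_ (toList (bindV ρ ts)) (toList h))
            (trans (bindV-cong e (Production.targs pr)) (sym (bindV-bindV ρ us (Production.targs pr)))))
      (zip-≐ ρ ts (bindV us (Production.targs pr)))

    map-URAtoms : ∀ j us → URAtoms j (bindT σt ∘ us) ≡ map (substF σt) (URAtoms j us)
    map-URAtoms j us = trans (cong₂ _++_ (map-QAtoms (lookup Φ j) σt (λ _ → refl)) (map-PAtoms (lookup Φ j) σt (λ _ → refl)))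
                             (sym (map-++ _ (QAtoms (lookup Φ j) us) _))

    tr-conclusion : ∀ r → name r ≢ Subst → conclusion (tr r) ≡ substS σt (conclusion r)
    tr-conclusion (axiom _ _ _) _ = refl
    tr-conclusion (eqR _ _ _) _ = refl
    tr-conclusion (wk _ _ _ _ _ _) _ = refl
    tr-conclusion (cut _ _ _) _ = refl
    tr-conclusion (subst _ _ _) ns = ⊥-elim (ns refl)
    tr-conclusion (negL _ _ _) _ = refl
    tr-conclusion (negR _ _ _) _ = refl
    tr-conclusion (orL _ _ _ _) _ = refl
    tr-conclusion (orR _ _ _ _) _ = refl
    tr-conclusion (andL _ _ _ _) _ = refl
    tr-conclusion (andR _ _ _ _) _ = refl
    tr-conclusion (impL _ _ _ _) _ = refl
    tr-conclusion (impR _ _ _ _) _ = refl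
    tr-conclusion (allL _ _ _ _) _ = refl
    tr-conclusion (exR _ _ _ _) _ = refl
    tr-conclusion (allR _ _ _ _ _) _ = refl
    tr-conclusion (exL _ _ _ _ _) _ = refl
    tr-conclusion (eqL Γ Δ x y t u) _ = cong₂ (λ A B → (_ ∷ A) ⊢ B) (map-eqσ x y t u Γ) (map-eqσ x y t u Δ)
    tr-conclusion (unfoldL _ _ _ _ _ _ _) _ = refl
    tr-conclusion (unfoldR Γ Δ j us) _ =
      cong (λ ts → map (substF σt) Γ ⊢ (ind _ ts ∷ map (substF σt) Δ))
           (sym (bindV-bindV σt us (Production.targs (lookup Φ j))))

    -- Only (UR) needs more than the identity: its premises are indexed by positions in a list of
    -- atoms, and the translated list is only provably equal to the image of the original one.
    ι : ∀ r → PremIx (tr r) → PremIx r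
    ι (wk _ _ _ _ _ _) i = i
    ι (cut _ _ _) i = i
    ι (subst _ _ _) i = i
    ι (negL _ _ _) i = i
    ι (negR _ _ _) i = i
    ι (orL _ _ _ _) i = i
    ι (orR _ _ _ _) i = i
    ι (andL _ _ _ _) i = i
    ι (andR _ _ _ _) i = i
    ι (impL _ _ _ _) i = i
    ι (impR _ _ _ _) i = i
    ι (allL _ _ _ _) i = i
    ι (exR _ _ _ _) i = i
    ι (allR _ _ _ _ _) i = i
    ι (exL _ _ _ _ _) i = i
    ι (eqL _ _ _ _ _ _) i = i
    ι (unfoldL _ _ _ _ _ _ _) i = i
    ι (unfoldR _ _ j us) i = unmapIx (substF σt) (URAtoms j us) (≡.subst (Fin ∘ length) (map-URAtoms j us) i)

    module _ (key : ℕ → K) where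
      ρ : ∀ r → PremIx r → ℕ → Code K
      ρ (subst θ _ _) _ = λ x → substCode key x (⟦ θ ⟧ x)
      ρ (allR _ _ _ y _) _ = rename {1} (λ _ → y)
      ρ (exL _ _ _ y _) _ = rename {1} (λ _ → y)
      ρ (unfoldL _ _ _ _ ys _ _) j = rename (ys j)
      ρ _ _ = σ

      ρt : ∀ r → PremIx r → ℕ → Term ℕ
      ρt r i = ⟦_⟧c ∘ ρ r i

      rename-local : ∀ {k} {ys : Fin k → ℕ} {A} → (∀ i → ¬ FreeIn (ys i) A) →
                     ∀ x → FreeIn x A → ⟦ rename ys x ⟧c ≡ σt x
      rename-local {ys = ys} nf x f = cong ⟦_⟧c (rename-∉ {ys = ys} (λ { i refl → nf i f }))

      rename-map : ∀ {k} {ys : Fin k → ℕ} {A} → (∀ i → ¬ FreeIn (ys i) A) →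
                   ∀ {Γ} → (∀ φ → φ ∈ Γ → φ ∈ A) →
                   map (substF σt) Γ ≡ map (substF (⟦_⟧c ∘ rename ys)) Γ
      rename-map {ys = ys} nf {Γ} ⊆A = sym (map-local Γ (λ { x (φ , m , f) → rename-local {ys = ys} nf x (φ , ⊆A φ m , f) }))

      1-inj : ∀ {y : ℕ} → Injective {A = Fin 1} _≡_ _≡_ (λ _ → y)
      1-inj {x = Fin.zero} {y = Fin.zero} _ = refl

      rename-inst : ∀ {y A} φ → ¬ FreeIn y A → (∀ x → FreeF (suc x) φ → FreeIn x A) →
                    (substF (⇑ σt) φ) [ var (fr 0) ]₀ ≡ substF (⟦_⟧c ∘ rename {1} (λ _ → y)) (φ [ var y ]₀)
      rename-inst {y} φ nf inA = sym (trans
        (substF-inst-local σt (⟦_⟧c ∘ rename {1} (λ _ → y)) φ (var y) (λ x f → rename-local {1} {λ _ → y} (λ _ → nf) x (inA x f)))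
        (cong (λ w → (substF (⇑ σt) φ) [ ⟦ w ⟧c ]₀) (rename-∈ {1} {λ _ → y} 1-inj Fin.zero)))

      tr-premise : ∀ r → name r ≢ Subst → ∀ i → premise (tr r) i ≡ substS (ρt r (ι r i)) (premise r (ι r i))
      tr-premise (wk _ _ _ _ _ _) _ i = refl
      tr-premise (cut _ _ _) _ Fin.zero = refl
      tr-premise (cut _ _ _) _ (Fin.suc _) = refl
      tr-premise (subst _ _ _) ns i = ⊥-elim (ns refl)
      tr-premise (negL _ _ _) _ i = refl
      tr-premise (negR _ _ _) _ i = refl
      tr-premise (orL _ _ _ _) _ Fin.zero = refl
      tr-premise (orL _ _ _ _) _ (Fin.suc _) = refl
      tr-premise (orR _ _ _ _) _ i = refl
      tr-premise (andL _ _ _ _) _ i = refl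
      tr-premise (andR _ _ _ _) _ Fin.zero = refl
      tr-premise (andR _ _ _ _) _ (Fin.suc _) = refl
      tr-premise (impL _ _ _ _) _ Fin.zero = refl
      tr-premise (impL _ _ _ _) _ (Fin.suc _) = refl
      tr-premise (impR _ _ _ _) _ i = refl
      tr-premise (allL Γ Δ φ t) _ i =
        cong (λ ψ → (ψ ∷ map (substF σt) Γ) ⊢ map (substF σt) Δ) (sym (substF-inst σt φ t))
      tr-premise (exR Γ Δ φ t) _ i =
        cong (λ ψ → map (substF σt) Γ ⊢ (ψ ∷ map (substF σt) Δ)) (sym (substF-inst σt φ t))
      tr-premise (allR Γ Δ φ y nf) _ i = cong₂ _⊢_
        (rename-map {1} (λ _ → nf) (λ _ → ∈-++⁺ˡ))
        (cong₂ _∷_ (rename-inst φ nf (λ x f → ∀' φ , ∈-++⁺ʳ Γ (here refl) , f))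
                   (rename-map {1} (λ _ → nf) (λ _ m → ∈-++⁺ʳ Γ (there m))))
      tr-premise (exL Γ Δ φ y nf) _ i = cong₂ _⊢_
        (cong₂ _∷_ (rename-inst φ nf (λ x f → ∃' φ , here refl , f))
                   (rename-map {1} (λ _ → nf) (λ _ m → there (∈-++⁺ˡ m))))
        (rename-map {1} (λ _ → nf) (λ _ m → there (∈-++⁺ʳ Γ m)))
      tr-premise (eqL Γ Δ x y t u) _ i = cong₂ _⊢_ (map-eqσ x y u t Γ) (map-eqσ x y u t Δ)
      tr-premise (unfoldL Γ Δ p us ys inj nf) _ j = cong₂ _⊢_
        (trans (cong₂ _++_ (rename-map (nf j) (λ _ m → there (∈-++⁺ˡ m)))
                 (trans (cong₂ _++_ eqs (cong₂ _++_ (map-QAtoms pr τ e) (map-PAtoms pr τ e)))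
                        (sym (trans (map-++ _ (HeadEqs pr (ULinst ys j) us) _)
                                    (cong (map (substF τ) (HeadEqs pr (ULinst ys j) us) ++_) (map-++ _ (QAtoms pr (ULinst ys j)) _))))))
               (sym (map-++ _ Γ _)))
        (rename-map (nf j) (λ _ m → there (∈-++⁺ʳ Γ m)))
        where
        pr = lookup Φ (proj₁ j)
        τ = ⟦_⟧c ∘ rename (ys j)
        us' : Fin (Production.k pr) → Term ℕ
        us' i = var (fr (toℕ i))
        e : ∀ i → us' i ≡ bindT τ (ULinst ys j i)
        e i = sym (cong ⟦_⟧c (rename-∈ (inj j) i))
        eqs : HeadEqs pr us' (bindV σt us) ≡ map (substF τ) (HeadEqs pr (ULinst ys j) us)
        eqs = trans (cong (HeadEqs pr us')
                          (bindV-local us (λ x f → sym (rename-local {ys = ys j} (nf j) x (ind p us , here refl , f)))))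
                    (map-HeadEqs pr τ e us)
      tr-premise (unfoldR Γ Δ j us) _ i =
        cong (λ ψ → map (substF σt) Γ ⊢ (ψ ∷ map (substF σt) Δ))
             (trans (lookup-subst (map-URAtoms j us) i) (lookup-unmapIx (substF σt) (URAtoms j us) _))

      same : ∀ {C C' : Formula} {b : Bool} → (b ≡ false) × (C' ≡ C) → (b ≡ false) × (substF σt C' ≡ substF σt C)
      same (b , e) = b , cong (substF σt) e

      renamed : ∀ {k} {ys : Fin k → ℕ} {A} → (∀ i → ¬ FreeIn (ys i) A) →
                ∀ {C C' : Formula} {b : Bool} → C ∈ A → (b ≡ false) × (C' ≡ C) →
                (b ≡ false) × (substF (⟦_⟧c ∘ rename ys) C' ≡ substF σt C)
      renamed {ys = ys} nf {C} m (b , refl) = b , substF-local C (λ x f → rename-local {ys = ys} nf x (C , m , f))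

      -- Membership of `C` in the conclusion guarantees that the eigenvariables are not free in `C`,
      -- so that the renamed substitution of the premise acts on `C` as `σ` does.
      tr-corr : ∀ r → name r ≢ Subst → ∀ i {C C' b} → C ∈ ante (conclusion r) → Corr r (ι r i) C C' b →
                Corr (tr r) i (substF σt C) (substF (ρt r (ι r i)) C') b
      tr-corr (wk _ _ _ _ _ _) _ i _ = same
      tr-corr (cut _ _ _) _ i _ = same
      tr-corr (subst _ _ _) ns i _ = ⊥-elim (ns refl)
      tr-corr (negL _ _ _) _ i _ = same
      tr-corr (negR _ _ _) _ i _ = same
      tr-corr (orL _ _ _ _) _ i _ = same
      tr-corr (orR _ _ _ _) _ i _ = same
      tr-corr (andL _ _ _ _) _ i _ = same
      tr-corr (andR _ _ _ _) _ i _ = same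
      tr-corr (impL _ _ _ _) _ i _ = same
      tr-corr (impR _ _ _ _) _ i _ = same
      tr-corr (allL _ _ _ _) _ i _ = same
      tr-corr (exR _ _ _ _) _ i _ = same
      tr-corr (allR Γ Δ φ y nf) _ i m = renamed {1} (λ _ → nf) (∈-++⁺ˡ m)
      tr-corr (exL Γ Δ φ y nf) _ i m = renamed {1} (λ _ → nf) (∈-++⁺ˡ m)
      tr-corr (eqL Γ Δ x y t u) _ i _ (b , D , m , refl , refl) =
        b , substF (eqσ x y) D , ∈-map⁺ _ m , sym (substF-eqσ x y t u D) , sym (substF-eqσ x y u t D)
      tr-corr (unfoldL Γ Δ p us ys inj nf) _ j m (inj₁ q) = inj₁ (renamed (nf j) (∈-++⁺ˡ m) q)
      tr-corr (unfoldL Γ Δ p us ys inj nf) _ j {C' = C'} m (inj₂ (b , refl , q)) =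
        inj₂ (b , refl , ≡.subst (substF (⟦_⟧c ∘ rename (ys j)) C' ∈_)
                           (sym (map-PAtoms (lookup Φ (proj₁ j)) (⟦_⟧c ∘ rename (ys j))
                                  (λ i → sym (cong ⟦_⟧c (rename-∈ (inj j) i)))))
                           (∈-map⁺ _ q))
      tr-corr (unfoldR _ _ _ _) _ i _ = same

  -- A bound on the eigenvariables needed by any one premise: the sum covers every production, and
  -- `suc` leaves one for the quantifier rules even if `Φ` is empty.
  maxK : ℕ
  maxK = suc (sum (map Production.k Φ))

  k≤sum : ∀ (Ψ : List Production) j → Production.k (lookup Ψ j) ≤ sum (map Production.k Ψ)
  k≤sum (pr ∷ Ψ) Fin.zero    = m≤m+n _ _
  k≤sum (pr ∷ Ψ) (Fin.suc j) = ≤-trans (k≤sum Ψ j) (m≤n+m _ (Production.k pr))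

  module _ (E : Env) (key : ℕ → K) (P : Code K → Set) (pσ : ∀ x → P (Env.σ E x))
           (pfr : ∀ n → n < maxK → P (v (Env.fr E n))) where
    open Env E

    substCode-all : ∀ x → P (c (key x)) → ∀ t → P (substCode key x t)
    substCode-all x pc (var z)  = pσ z
    substCode-all x pc (fn _ _) = pc

    -- Every code in a premise's substitution comes from `σ`, from the first `maxK` fresh variables,
    -- or from a constant keyed at the variable in question. Any property of these three sources is
    -- therefore inherited; it will be membership in a finite pool.
    ρ-all : ∀ r i x → P (c (key x)) → P (ρ key r i x)
    ρ-all (wk _ _ _ _ _ _) _ x _ = pσ x
    ρ-all (cut _ _ _) _ x _ = pσ x
    ρ-all (subst θ _ _) _ x pc = substCode-all x pc (⟦ θ ⟧ x)
    ρ-all (negL _ _ _) _ x _ = pσ x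
    ρ-all (negR _ _ _) _ x _ = pσ x
    ρ-all (orL _ _ _ _) _ x _ = pσ x
    ρ-all (orR _ _ _ _) _ x _ = pσ x
    ρ-all (andL _ _ _ _) _ x _ = pσ x
    ρ-all (andR _ _ _ _) _ x _ = pσ x
    ρ-all (impL _ _ _ _) _ x _ = pσ x
    ρ-all (impR _ _ _ _) _ x _ = pσ x
    ρ-all (allL _ _ _ _) _ x _ = pσ x
    ρ-all (exR _ _ _ _) _ x _ = pσ x
    ρ-all (allR _ _ _ y _) _ x _ = rename-all {1} (λ _ → y) P pσ (λ n l → pfr n (≤-trans l (s≤s z≤n))) x
    ρ-all (exL _ _ _ y _) _ x _ = rename-all {1} (λ _ → y) P pσ (λ n l → pfr n (≤-trans l (s≤s z≤n))) x
    ρ-all (eqL _ _ _ _ _ _) _ x _ = pσ x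
    ρ-all (unfoldL _ _ _ _ ys _ _) j x _ =
      rename-all (ys j) P pσ (λ n l → pfr n (≤-trans l (≤-trans (k≤sum Φ (proj₁ j)) (m≤n+m _ 1)))) x
    ρ-all (unfoldR _ _ _ _) _ x _ = pσ x

-- Fresh variables with small bounds.

index-∈-injective : ∀ {A : Set} {x y : A} {xs} (p : x ∈ xs) (q : y ∈ xs) → index p ≡ index q → x ≡ y
index-∈-injective {xs = xs} p q e = trans (lookup-index p) (trans (cong (lookup xs) e) (sym (lookup-index q)))

-- Pigeonhole: the first `suc (length xs)` numbers cannot all occur in `xs`. The bound depends on
-- the length and not on the entries, which keeps variables from drifting upwards along the
-- unfolding.
fresh : ∀ (xs : List ℕ) → ∃ λ y → y ∉ xs × y ≤ length xs
fresh xs with ¬∀⟶∃¬ (suc (length xs)) (λ i → toℕ i ∈ xs) (λ i → DecMembership._∈?_ _≟_ (toℕ i) xs) not-all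
  where
  not-all : ¬ (∀ (i : Fin (suc (length xs))) → toℕ i ∈ xs)
  not-all h with pigeonhole (n<1+n (length xs)) (λ i → index (h i))
  ... | i , j , i<j , e = <⇒≢ i<j (index-∈-injective (h i) (h j) e)
... | i , i∉ = toℕ i , i∉ , ≤-pred (toℕ<n i)

freshes : List ℕ → ℕ → ℕ
freshes xs zero    = proj₁ (fresh xs)
freshes xs (suc n) = freshes (proj₁ (fresh xs) ∷ xs) n

freshes-∉ : ∀ xs n → freshes xs n ∉ xs
freshes-∉ xs zero    = proj₁ (proj₂ (fresh xs))
freshes-∉ xs (suc n) = freshes-∉ (proj₁ (fresh xs) ∷ xs) n ∘ there

freshes-≤ : ∀ xs n → freshes xs n ≤ length xs + n
freshes-≤ xs zero    = ≤-trans (proj₂ (proj₂ (fresh xs))) (≤-reflexive (sym (+-identityʳ _)))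
freshes-≤ xs (suc n) = ≤-trans (freshes-≤ _ n) (≤-reflexive (sym (+-suc _ n)))

freshes-injective : ∀ xs → Injective _≡_ _≡_ (freshes xs)
freshes-injective xs {zero}  {zero}  e = refl
freshes-injective xs {zero}  {suc n} e = ⊥-elim (freshes-∉ _ n (here (sym e)))
freshes-injective xs {suc m} {zero}  e = ⊥-elim (freshes-∉ _ m (here e))
freshes-injective xs {suc m} {suc n} e = cong suc (freshes-injective _ e)

-- Finiteness: counting duplicate-free lists, and Noetherian sets.

unique-lookup-injective : ∀ {A : Set} {xs : List A} → Unique xs → Injective _≡_ _≡_ (lookup xs)
unique-lookup-injective (px ∷ u) {Fin.zero}  {Fin.zero}  e = refl
unique-lookup-injective (px ∷ u) {Fin.zero}  {Fin.suc j} e = ⊥-elim (All.lookup px (∈-lookup j) e)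
unique-lookup-injective (px ∷ u) {Fin.suc i} {Fin.zero}  e = ⊥-elim (All.lookup px (∈-lookup i) (sym e))
unique-lookup-injective (px ∷ u) {Fin.suc i} {Fin.suc j} e = cong Fin.suc (unique-lookup-injective u e)

unique-⊆-length : ∀ {A : Set} {xs ys : List A} → Unique xs → (∀ {x} → x ∈ xs → x ∈ ys) → length xs ≤ length ys
unique-⊆-length {xs = xs} {ys} u sub = injective⇒≤ {f = f} inj
  where
  f : Fin (length xs) → Fin (length ys)
  f i = index (sub (∈-lookup {xs = xs} i))
  inj : Injective _≡_ _≡_ f
  inj {i} {j} e = unique-lookup-injective u
    (index-∈-injective (sub (∈-lookup {xs = xs} i)) (sub (∈-lookup {xs = xs} j)) e)

-- An inductive bar: `h` is the list of elements enumerated so far, and recursion may continue only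
-- with an element outside it.
data Noeth (A : Set) (h : List A) : Set where
  step : (∀ a → a ∉ h → Noeth A (a ∷ h)) → Noeth A h

noeth-⊤ : Noeth ⊤ []
noeth-⊤ = step (λ _ _ → step (λ _ ∉ → ⊥-elim (∉ (here refl))))

noeth-injection : ∀ {A B : Set} (f : A → B) → Injective _≡_ _≡_ f → ∀ {h k} →
                  (∀ a → f a ∈ k → a ∈ h) → Noeth B k → Noeth A h
noeth-injection f inj {h} {k} inv (step n) = step (λ a a∉ → noeth-injection f inj (inv' a) (n (f a) (a∉ ∘ inv a)))
  where
  inv' : ∀ a a' → f a' ∈ f a ∷ k → a' ∈ a ∷ h
  inv' a a' (here e)  = here (inj e)
  inv' a a' (there m) = there (inv a' m)

-- Each new element of the sum consumes one step of one of the two derivations and leaves the other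
-- as it was.
noeth-⊎ : ∀ {A B : Set} {h hA hB} → (∀ a → a ∈ hA → inj₁ a ∈ h) → (∀ b → b ∈ hB → inj₂ b ∈ h) →
          Noeth A hA → Noeth B hB → Noeth (A ⊎ B) h
noeth-⊎ {h = h} {hA} {hB} invA invB nA@(step fA) nB@(step fB) = step go
  where
  go : ∀ x → x ∉ h → Noeth _ (x ∷ h)
  go (inj₁ a) ∉h = noeth-⊎ (λ { _ (here refl) → here refl ; a' (there m) → there (invA a' m) })
                           (λ b m → there (invB b m)) (fA a (∉h ∘ invA a)) nB
  go (inj₂ b) ∉h = noeth-⊎ (λ a m → there (invA a m))
                           (λ { _ (here refl) → here refl ; b' (there m) → there (invB b' m) })
                           nA (fB b (∉h ∘ invB b))

-- It is never decided whether `X` is inhabited: the first element enumerated brings an index with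
-- it, and all later ones have the same index.
noeth-Σ-prop : ∀ {X : Set} {A : X → Set} → (∀ x y → x ≡ y) → (∀ x → Noeth (A x) []) → Noeth (Σ X A) []
noeth-Σ-prop {X} {A} prop n = step (λ { (x , a) _ → go {hA = []} (λ _ ()) (n x) })
  where
  go : ∀ {h x hA} → (∀ a → a ∈ hA → (x , a) ∈ h) → Noeth (A x) hA → Noeth (Σ X A) h
  go {h} {x} inv (step f) = step next
    where
    next : ∀ y → y ∉ h → Noeth (Σ X A) (y ∷ h)
    next (y , a) ∉h with refl ← prop x y =
      go (λ { _ (here refl) → here refl ; b (there m) → there (inv b m) }) (f a (∉h ∘ inv a))

noeth-Σ-Fin : ∀ n {A : Fin n → Set} → (∀ i → Noeth (A i) []) → Noeth (Σ (Fin n) A) []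
noeth-Σ-Fin zero    _ = step (λ { (() , _) })
noeth-Σ-Fin (suc n) {A} h = noeth-injection split split-inj {k = []} (λ _ ())
  (noeth-⊎ {hA = []} {hB = []} (λ _ ()) (λ _ ()) (h Fin.zero) (noeth-Σ-Fin n (h ∘ Fin.suc)))
  where
  split : Σ (Fin (suc n)) A → A Fin.zero ⊎ Σ (Fin n) (A ∘ Fin.suc)
  split (Fin.zero  , a) = inj₁ a
  split (Fin.suc i , a) = inj₂ (i , a)
  split-inj : Injective _≡_ _≡_ split
  split-inj {Fin.zero , _}  {Fin.zero , _}  refl = refl
  split-inj {Fin.suc _ , _} {Fin.suc _ , _} refl = refl

-- Splits the sum along `code` into finitely many fibres. Each fibre has at most one index, by
-- injectivity, although it may be unknown whether it has any.
noeth-Σ : ∀ {I : Set} {A : I → Set} {n} (code : I → Fin n) → Injective _≡_ _≡_ code →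
          (∀ i → Noeth (A i) []) → Noeth (Σ I A) []
noeth-Σ {I} {A} {n} code inj h =
  noeth-injection toFibre (λ { refl → refl }) {k = []} (λ _ ())
    (noeth-Σ-Fin n (λ j → noeth-Σ-prop (fibre-prop j) (h ∘ proj₁)))
  where
  Fibre : Fin n → Set
  Fibre j = Σ I λ i → code i ≡ j
  fibre-prop : ∀ j (x y : Fibre j) → x ≡ y
  fibre-prop j (i , refl) (i' , e) with refl ← inj e | refl ← e = refl
  toFibre : Σ I A → Σ (Fin n) λ j → Σ (Fibre j) (A ∘ proj₁)
  toFibre (i , a) = code i , (i , refl) , a

-- Vectors of codes as finite substitutions.

code-≟ : ∀ {K : Set} → DecidableEquality K → DecidableEquality (Code K)
code-≟ _≟K_ (v m) (v n) with m ≟ n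
... | yes refl = yes refl
... | no m≢n   = no (λ { refl → m≢n refl })
code-≟ _≟K_ (v m) (c k) = no (λ ())
code-≟ _≟K_ (c k) (v n) = no (λ ())
code-≟ _≟K_ (c k) (c l) with k ≟K l
... | yes refl = yes refl
... | no k≢l   = no (λ { refl → k≢l refl })

look : ∀ {K : Set} {n} → Vec (Code K) n → ℕ → Code K
look []       x       = v 0
look (a ∷ as) zero    = a
look (a ∷ as) (suc x) = look as x

look-tabulate : ∀ {K : Set} n (f : ℕ → Code K) x → x < n → look (tabulate {n = n} (f ∘ toℕ)) x ≡ f x
look-tabulate (suc n) f zero    l       = refl
look-tabulate (suc n) f (suc x) (s≤s l) = look-tabulate n (f ∘ suc) x l

look-all : ∀ {K : Set} {P : Code K → Set} {n} (as : Vec (Code K) n) → P (v 0) →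
           All P (toList as) → ∀ x → P (look as x)
look-all []       p0 []       x       = p0
look-all (a ∷ as) p0 (p ∷ ps) zero    = p
look-all (a ∷ as) p0 (p ∷ ps) (suc x) = look-all as p0 ps x

tabulate-all : ∀ {K : Set} {P : Code K → Set} n (f : ℕ → Code K) → (∀ x → x < n → P (f x)) →
               All P (toList (tabulate {n = n} (f ∘ toℕ)))
tabulate-all zero    f p = []
tabulate-all (suc n) f p = p 0 (s≤s z≤n) ∷ tabulate-all n (f ∘ suc) (λ x l → p (suc x) (s≤s l))

codeVar : ∀ {K : Set} → Code K → ℕ
codeVar (v n) = n
codeVar (c _) = 0

-- 0 is always avoided: var 0 is the junk value of look and of the interpretation of constant codes.
avoid : ∀ {K : Set} {n} → Vec (Code K) n → List ℕ
avoid as = 0 ∷ map codeVar (toList as)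

length-avoid : ∀ {K : Set} {n} (as : Vec (Code K) n) → length (avoid as) ≡ suc n
length-avoid as = cong suc (trans (length-map codeVar (toList as)) (length-toList as))

codeVar-look : ∀ {K : Set} {n} (as : Vec (Code K) n) x → codeVar (look as x) ∈ avoid as
codeVar-look as x = look-all {P = λ a → codeVar a ∈ avoid as} as (here refl)
                      (All.tabulate (λ m → there (∈-map⁺ codeVar m))) x

allVecs : ∀ {A : Set} → List A → ∀ n → List (Vec A n)
allVecs xs zero    = [] ∷ []
allVecs xs (suc n) = List.cartesianProductWith _∷_ xs (allVecs xs n)

∈-allVecs : ∀ {A : Set} {xs : List A} {n} (as : Vec A n) → All (_∈ xs) (toList as) → as ∈ allVecs xs n
∈-allVecs []       []       = here refl
∈-allVecs (a ∷ as) (p ∷ ps) = ∈-cartesianProductWith⁺ _∷_ p (∈-allVecs as ps)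

-- Positions, kinds of inference and steps of a pre-proof.

module CalculusProperties (S : Signature) (Φ : List (Syntax.Production S)) where
  open Signature S
  open Syntax S
  open SyntaxProperties S
  open Calculus S Φ

  -- Only an injection is asked for. For (UL) its image consists of the productions whose head
  -- equals `p`, which is undecided; decidable equality of premise indices follows all the same.
  Finite : Set → Set
  Finite I = Σ ℕ λ n → Σ (I → Fin n) λ f → Injective _≡_ _≡_ f

  finite-Fin : ∀ {n} → Finite (Fin n)
  finite-Fin = _ , id , id

  premIx-finite : ∀ r → Finite (PremIx r)
  premIx-finite (axiom _ _ _) = finite-Fin
  premIx-finite (eqR _ _ _) = finite-Fin
  premIx-finite (wk _ _ _ _ _ _) = finite-Fin
  premIx-finite (cut _ _ _) = finite-Fin
  premIx-finite (subst _ _ _) = finite-Fin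
  premIx-finite (negL _ _ _) = finite-Fin
  premIx-finite (negR _ _ _) = finite-Fin
  premIx-finite (orL _ _ _ _) = finite-Fin
  premIx-finite (orR _ _ _ _) = finite-Fin
  premIx-finite (andL _ _ _ _) = finite-Fin
  premIx-finite (andR _ _ _ _) = finite-Fin
  premIx-finite (impL _ _ _ _) = finite-Fin
  premIx-finite (impR _ _ _ _) = finite-Fin
  premIx-finite (allL _ _ _ _) = finite-Fin
  premIx-finite (exR _ _ _ _) = finite-Fin
  premIx-finite (allR _ _ _ _ _) = finite-Fin
  premIx-finite (exL _ _ _ _ _) = finite-Fin
  premIx-finite (eqL _ _ _ _ _ _) = finite-Fin
  -- The number of the production determines the premise, since proofs of an equality of predicate
  -- symbols are unique by axiom K.
  premIx-finite (unfoldL _ _ _ _ _ _ _) = _ , proj₁ , λ { {_ , refl} {_ , refl} refl → refl }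
  premIx-finite (unfoldR _ _ _ _) = finite-Fin

  premIx-≟ : ∀ r → DecidableEquality (PremIx r)
  premIx-≟ r i j with premIx-finite r
  ... | n , f , inj with f i Fin.≟ f j
  ...   | yes e = yes (inj e)
  ...   | no ¬e = no (λ { refl → ¬e refl })

  pos-≟ : ∀ {t} → DecidableEquality (Pos t)
  pos-≟ here here = yes refl
  pos-≟ here (there _ _) = no (λ ())
  pos-≟ (there _ _) here = no (λ ())
  pos-≟ (there {r = r} i p) (there j q) with premIx-≟ r i j
  ... | no i≢j = no (λ { refl → i≢j refl })
  ... | yes refl with pos-≟ p q
  ...   | yes refl = yes refl
  ...   | no p≢q   = no (λ { refl → p≢q refl })

  noeth-Pos : ∀ t → Noeth (Pos t) []
  noeth-Pos (bud s) = noeth-injection {B = ⊤} (λ _ → tt) (λ { {here} {here} _ → refl }) {k = []} (λ _ ()) noeth-⊤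
  noeth-Pos (inf s r ts) = noeth-injection split split-inj {k = []} (λ _ ())
    (noeth-⊎ {hA = []} {hB = []} (λ _ ()) (λ _ ()) noeth-⊤
      (noeth-Σ (proj₁ (proj₂ (premIx-finite r))) (proj₂ (proj₂ (premIx-finite r))) (λ i → noeth-Pos (ts i))))
    where
    split : Pos (inf s r ts) → ⊤ ⊎ Σ (PremIx r) (λ i → Pos (ts i))
    split here        = inj₁ tt
    split (there i p) = inj₂ (i , p)
    split-inj : Injective _≡_ _≡_ split
    split-inj {here}      {here}      _    = refl
    split-inj {there _ _} {there _ _} refl = refl

  childT : ∀ t → ChildIx t → Tree
  childT (inf _ _ ts) i = ts i

  premT : ∀ t → ChildIx t → Sequent
  premT (inf _ r _) i = premise r i

  at-extend : ∀ {t} (p : Pos t) i → at (extend p i) ≡ childT (at p) i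
  at-extend {inf _ _ _} here i = refl
  at-extend (there _ p) i = at-extend p i

  extend-injective : ∀ {t} (p : Pos t) {i j} → extend p i ≡ extend p j → i ≡ j
  extend-injective {inf _ _ _} here refl = refl
  extend-injective (there k p) {i} {j} e = extend-injective p (there-injective e)
    where
    there-injective : ∀ {s r ts k} {p q : Pos (ts k)} → there {s} {r} {ts} k p ≡ there k q → p ≡ q
    there-injective refl = refl

  valid-at : ∀ {t} (p : Pos t) → Valid t → Valid (at p)
  valid-at here        w = w
  valid-at (there i p) w = valid-at p (proj₂ (proj₂ w i))

  atomic-at : ∀ {t} (p : Pos t) → AllSubstAtomic t → AllSubstAtomic (at p)
  atomic-at here        w = w
  atomic-at (there i p) w = atomic-at p (proj₂ w i)

  uses-at : ∀ {t n} (p : Pos t) → Uses (at p) n → Uses t n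
  uses-at here        u = u
  uses-at (there i p) u = inj₂ (i , uses-at p u)

  child-label : ∀ t → Valid t → ∀ i → label (childT t i) ≈S premT t i
  child-label (inf _ _ _) w i = proj₁ (proj₂ w i)

  IsSubst : Rule → Set
  IsSubst r = Σ Substitution λ θ → Σ (List Formula) λ Γ → Σ (List Formula) λ Δ → r ≡ subst θ Γ Δ

  subst-or-not : ∀ r → name r ≢ Subst ⊎ IsSubst r
  subst-or-not (axiom _ _ _) = inj₁ (λ ())
  subst-or-not (eqR _ _ _) = inj₁ (λ ())
  subst-or-not (wk _ _ _ _ _ _) = inj₁ (λ ())
  subst-or-not (cut _ _ _) = inj₁ (λ ())
  subst-or-not (subst θ Γ Δ) = inj₂ (θ , Γ , Δ , refl)
  subst-or-not (negL _ _ _) = inj₁ (λ ())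
  subst-or-not (negR _ _ _) = inj₁ (λ ())
  subst-or-not (orL _ _ _ _) = inj₁ (λ ())
  subst-or-not (orR _ _ _ _) = inj₁ (λ ())
  subst-or-not (andL _ _ _ _) = inj₁ (λ ())
  subst-or-not (andR _ _ _ _) = inj₁ (λ ())
  subst-or-not (impL _ _ _ _) = inj₁ (λ ())
  subst-or-not (impR _ _ _ _) = inj₁ (λ ())
  subst-or-not (allL _ _ _ _) = inj₁ (λ ())
  subst-or-not (exR _ _ _ _) = inj₁ (λ ())
  subst-or-not (allR _ _ _ _ _) = inj₁ (λ ())
  subst-or-not (exL _ _ _ _ _) = inj₁ (λ ())
  subst-or-not (eqL _ _ _ _ _ _) = inj₁ (λ ())
  subst-or-not (unfoldL _ _ _ _ _ _ _) = inj₁ (λ ())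
  subst-or-not (unfoldR _ _ _ _) = inj₁ (λ ())

  IsRule : Tree → Set
  IsRule (inf _ r _) = name r ≢ Subst
  IsRule (bud _)     = ⊥

  conclT : ∀ t → IsRule t → Sequent
  conclT (inf _ r _) _ = conclusion r

  IsSub : Tree → Set
  IsSub (inf _ r _) = IsSubst r
  IsSub (bud _)     = ⊥

  subIx : ∀ t → IsSub t → ChildIx t
  subIx (inf _ _ _) (_ , _ , _ , refl) = Fin.zero

  theta : ∀ t → IsSub t → Substitution
  theta (inf _ _ _) (θ , _) = θ

  sub-label : ∀ t → Valid t → (h : IsSub t) → label t ≈S substS ⟦ theta t h ⟧ (premT t (subIx t h))
  sub-label (inf _ _ _) w (_ , _ , _ , refl) = proj₁ w

  sub-corr : ∀ t h {C C' b} → CorrT t (subIx t h) C C' b → b ≡ false × C ≡ substF ⟦ theta t h ⟧ C'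
  sub-corr (inf _ _ _) (_ , _ , _ , refl) corr = corr

  rule-label : ∀ t → Valid t → (h : IsRule t) → label t ≈S conclT t h
  rule-label (inf _ _ _) w _ = proj₁ w

  kind : ∀ t → IsRule t ⊎ IsSub t ⊎ IsBud t
  kind (inf _ r _) with subst-or-not r
  ... | inj₁ h = inj₁ h
  ... | inj₂ h = inj₂ (inj₁ h)
  kind (bud _) = inj₂ (inj₂ tt)

  bud-childless : ∀ t → IsBud t → ¬ ChildIx t
  bud-childless (bud _) _ ()

  bud-not-inf : ∀ t → IsBud t → ¬ IsInf t
  bud-not-inf (bud _) _ ()

  sub-no-progress : ∀ t i → IsSub t → ∀ {C C'} → ¬ CorrT t i C C' true
  sub-no-progress (inf _ _ _) i (_ , _ , _ , refl) (() , _)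

  -- Inversion with a variable as target: `extend p i` is not in constructor form, so a step towards
  -- it cannot be matched directly.
  step-child : ∀ (pp : PreProof) {p q C C' b} → Step pp p q C C' b →
               (Σ (ChildIx (at p)) λ i → q ≡ extend p i × CorrT (at p) i C C' b)
               ⊎ (IsBud (at p) × C' ≡ C × b ≡ false)
  step-child pp (childS p i corr) = inj₁ (i , refl , corr)
  step-child pp (compS p bd C)    = inj₂ (bd , refl , refl)

  step-corr : ∀ (pp : PreProof) {p} i {C C' b} → Step pp p (extend p i) C C' b → CorrT (at p) i C C' b
  step-corr pp {p} i {C} {C'} {b} st with step-child pp st
  ... | inj₁ (j , e , corr) = ≡.subst (λ k → CorrT (at p) k C C' b) (sym (extend-injective p e)) corr
  ... | inj₂ (bd , _)       = ⊥-elim (bud-childless (at p) bd i)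

  step-bud : ∀ (pp : PreProof) {p q C C' b} → IsBud (at p) → Step pp p q C C' b → C' ≡ C × b ≡ false
  step-bud pp {p} bd st with step-child pp st
  ... | inj₁ (i , _)      = ⊥-elim (bud-childless (at p) bd i)
  ... | inj₂ (_ , e , e') = e , e'

  constant : Term ℕ → Term ℕ
  constant (var _) = var 0
  constant (fn f ts) with arF f ≟ 0
  ... | yes _ = fn f ts
  ... | no  _ = var 0

  no-free : ∀ {n y} → n ≡ 0 → (ts : Vec (Term ℕ) n) → ¬ FreeV y ts
  no-free refl [] ()

  bindV-nullary : ∀ {n} (σ : ℕ → Term ℕ) → n ≡ 0 → (ts : Vec (Term ℕ) n) → bindV σ ts ≡ ts
  bindV-nullary σ refl [] = refl

  free-constant : ∀ {y} t → FreeT y (constant t) → y ≡ 0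
  free-constant (var _) f = f
  free-constant (fn g ts) f with arF g ≟ 0
  ... | yes e = ⊥-elim (no-free e ts f)
  ... | no  _ = f

  constant-fn : ∀ (σ : ℕ → Term ℕ) f ts → arF f ≡ 0 → constant (fn f ts) ≡ bindT σ (fn f ts)
  constant-fn σ f ts e with arF f ≟ 0
  ... | yes _ = cong (fn f) (sym (bindV-nullary σ e ts))
  ... | no ¬e = ⊥-elim (¬e e)

  atomic-⟦⟧ : ∀ {θ} → Atomic θ → ∀ x → IsVarOrConst (⟦ θ ⟧ x)
  atomic-⟦⟧ [] x = tt
  atomic-⟦⟧ {(y , t) ∷ θ} (a ∷ as) x with x ≡ᵇ y
  ... | true  = a
  ... | false = atomic-⟦⟧ as x

  constantAt : Tree → ℕ → Term ℕ
  constantAt t x with kind t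
  ... | inj₂ (inj₁ h) = constant (⟦ theta t h ⟧ x)
  ... | _             = var 0

  free-constantAt : ∀ {y} t x → FreeT y (constantAt t x) → y ≡ 0
  free-constantAt t x f with kind t
  ... | inj₁ _        = f
  ... | inj₂ (inj₁ h) = free-constant (⟦ theta t h ⟧ x) f
  ... | inj₂ (inj₂ _) = f

-- States, and the derivation read off from an unfolding.

module Unfolding (S : Signature) (Φ : List (Syntax.Production S)) (pp : Calculus.PreProof S Φ) where
  open Signature S
  open Syntax S
  open SyntaxProperties S
  open Calculus S Φ
  open CalculusProperties S Φ

  P : Set
  P = Pos (tree pp)

  -- A constant in the image of a substitution is coded by the position of the (Subst) instance and
  -- the variable that it replaces, because equality of function symbols need not be decidable.
  K : Set
  K = P × ℕ

  kon : K → Term ℕ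
  kon (p , x) = constantAt (at p) x

  free-kon : ∀ {y} k → FreeT y (kon k) → y ≡ 0
  free-kon (p , x) = free-constantAt (at p) x

  open Interpretation S K kon
  open RuleTranslation S Φ K kon

  N : P → ℕ
  N p = boundS (label (at p))

  -- A vector and not a function, so that repetitions can be recognised. The length is `N p` because
  -- variables from `N p` on are not free in the sequent at `p`.
  State : Set
  State = Σ P λ p → Vec (Code K) (N p)

  state-≟ : DecidableEquality State
  state-≟ = Product.≡-dec pos-≟
    (Vec.≡-dec (code-≟ (Product.≡-dec pos-≟ _≟_)))

  free-code : ∀ {y} a → FreeT y ⟦ a ⟧c → y ≡ codeVar a
  free-code (v n) f = f
  free-code (c k) f = free-kon k f

  env : State → Env
  env (p , as) = record
    { σ      = look as
    ; fr     = freshes (avoid as)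
    ; fr-inj = freshes-injective (avoid as)
    ; fr-av  = λ n x f → freshes-∉ (avoid as) n
                 (≡.subst (_∈ avoid as) (sym (free-code (look as x) f)) (codeVar-look as x))
    }

  ⟦_⟧s : State → ℕ → Term ℕ
  ⟦ p , as ⟧s = ⟦_⟧c ∘ look as

  -- The tree is a separate argument, intended to be `at (proj₁ x)`, so that it can be matched;
  -- constants are keyed by the position in `x`.
  childCode : State → ∀ t → ChildIx t → ℕ → Code K
  childCode x (inf _ r _) i = Env.ρ (env x) (λ z → (proj₁ x , z)) r i

  restrict : ∀ p → (ℕ → Code K) → State
  restrict p f = p , tabulate (f ∘ toℕ)

  child-state : (x : State) → ChildIx (at (proj₁ x)) → State
  child-state x i = restrict (extend (proj₁ x) i) (childCode x (at (proj₁ x)) i)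

  comp-state : (x : State) → IsBud (at (proj₁ x)) → State
  comp-state x b = restrict (companion pp (proj₁ x) b) (look (proj₂ x))

  lab : State → Sequent
  lab x = substS ⟦ x ⟧s (label (at (proj₁ x)))

  lab-restrict : ∀ p f → lab (restrict p f) ≡ substS (⟦_⟧c ∘ f) (label (at p))
  lab-restrict p f = substS-bounded (label (at p)) (λ x l → cong ⟦_⟧c (look-tabulate (N p) f x l))

  ante-restrict : ∀ p f {C} → C ∈ ante (label (at p)) → substF ⟦ restrict p f ⟧s C ≡ substF (⟦_⟧c ∘ f) C
  ante-restrict p f {C} m = substF-local C (λ x fr → cong ⟦_⟧c (look-tabulate (N p) f x
    (<-⊔ (inj₁ (freeL-< (ante (label (at p))) m fr)))))

  -- `H` holds the states of the inferences on the branch from the root, and only `node` adds to it.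
  -- `jump` and `sub` produce no inference, because conclusion and premise become the same sequent
  -- up to set equality.
  data UTree (H : List State) : State → Set where
    back : ∀ {x} → x ∈ H → UTree H x
    jump : ∀ {x} (b : IsBud (at (proj₁ x))) → UTree H (comp-state x b) → UTree H x
    sub  : ∀ {x} (h : IsSub (at (proj₁ x))) → UTree H (child-state x (subIx _ h)) → UTree H x
    node : ∀ {x} (h : IsRule (at (proj₁ x))) →
           ((i : ChildIx (at (proj₁ x))) → UTree (x ∷ H) (child-state x i)) → UTree H x

  trT : State → ∀ t → IsRule t → Rule
  trT x (inf _ r _) _ = Env.tr (env x) r

  ιT : ∀ x t h → PremIx (trT x t h) → ChildIx t
  ιT x (inf _ r _) _ = Env.ι (env x) r

  toTree : ∀ {H x} → UTree H x → Tree
  toTree {x = x} (back _)    = bud (lab x)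
  toTree         (jump _ u)  = toTree u
  toTree         (sub _ u)   = toTree u
  toTree {x = x} (node h us) = inf (lab x) (trT x (at (proj₁ x)) h) (λ i → toTree (us (ιT x (at (proj₁ x)) h i)))

  stateAt : ∀ {H x} (u : UTree H x) → Pos (toTree u) → State
  stateAt {x = x} (back _)    _           = x
  stateAt         (jump _ u)  p           = stateAt u p
  stateAt         (sub _ u)   p           = stateAt u p
  stateAt {x = x} (node h us) here        = x
  stateAt         (node h us) (there i p) = stateAt (us _) p

  label-at : ∀ {H x} (u : UTree H x) p → label (at p) ≡ lab (stateAt u p)
  label-at (back _)    here        = refl
  label-at (jump _ u)  p           = label-at u p
  label-at (sub _ u)   p           = label-at u p
  label-at (node h us) here        = refl
  label-at (node h us) (there i p) = label-at (us _) p

  -- A state in `H` belongs to an inference outside the subtree and becomes a position when the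
  -- recursion returns to the `node` that put it there. At the root `H` is empty, so a companion is
  -- always found.
  comp : ∀ {H x} (u : UTree H x) p → IsBud (at p) →
         (Σ (Pos (toTree u)) λ q → IsInf (at q) × stateAt u q ≡ stateAt u p) ⊎ (stateAt u p ∈ H)
  comp (back m)    here        b = inj₂ m
  comp (jump _ u)  p           b = comp u p b
  comp (sub _ u)   p           b = comp u p b
  comp (node h us) (there i p) b with comp (us _) p b
  ... | inj₁ (q , w , e)   = inj₁ (there i q , w , e)
  ... | inj₂ (here e)      = inj₁ (here , tt , sym e)
  ... | inj₂ (there m)     = inj₂ m

  trT-conclusion : ∀ x t h → conclusion (trT x t h) ≡ substS ⟦ x ⟧s (conclT t h)
  trT-conclusion x (inf _ r _) h = Env.tr-conclusion (env x) r h

  trT-premise : ∀ x t h i → premise (trT x t h) i ≡ substS (⟦_⟧c ∘ childCode x t (ιT x t h i)) (premT t (ιT x t h i))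
  trT-premise x (inf _ r _) h i = Env.tr-premise (env x) (λ z → (proj₁ x , z)) r h i

  trT-corr : ∀ x t h i {C C' b} → C ∈ ante (conclT t h) → CorrT t (ιT x t h i) C C' b →
             Corr (trT x t h) i (substF ⟦ x ⟧s C) (substF (⟦_⟧c ∘ childCode x t (ιT x t h i)) C') b
  trT-corr x (inf _ r _) h i = Env.tr-corr (env x) (λ z → (proj₁ x , z)) r h i

  trT-name : ∀ x t h {n} → name (trT x t h) ≡ n → n ≢ Subst × Uses t n
  trT-name x (inf _ r _) h refl = (λ e → h (trans (sym (Env.tr-name (env x) r)) e)) , inj₁ (sym (Env.tr-name (env x) r))

  toTree-uses : ∀ {H x} (u : UTree H x) {n} → Uses (toTree u) n → n ≢ Subst × Uses (tree pp) n
  toTree-uses (jump _ u)            w              = toTree-uses u w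
  toTree-uses (sub _ u)             w              = toTree-uses u w
  toTree-uses {x = x} (node h us)   (inj₁ e)       with trT-name x (at (proj₁ x)) h e
  ... | ns , w = ns , uses-at (proj₁ x) w
  toTree-uses (node h us)           (inj₂ (i , w)) = toTree-uses (us _) w

  rootState : State
  rootState = restrict here v

  lab-root : lab rootState ≡ label (tree pp)
  lab-root = trans (lab-restrict here v) (substS-var (label (tree pp)))

  -- Only finitely many states arise over a given list of positions.

  Bound : P → ℕ
  Bound p = suc (N p) + maxK

  Below : List P → ℕ → Set
  Below h n = Any (λ q → n < Bound q) h

  -- A constant code names the (Subst) instance and the variable it replaced. Both are confined by
  -- the visited positions, which makes the good codes finite in number.
  Good : List P → Code K → Set
  Good h (v n)       = Below h n
  Good h (c (q , x)) = q ∈ h × Below h x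

  OkState : List P → State → Set
  OkState h x = All (Good h) (toList (proj₂ x))

  below-mono : ∀ {h h' n} → (∀ {q} → q ∈ h → q ∈ h') → Below h n → Below h' n
  below-mono inc b with find b
  ... | q , m , l = lose (inc m) l

  good-mono : ∀ {h h'} → (∀ {q} → q ∈ h → q ∈ h') → ∀ a → Good h a → Good h' a
  good-mono inc (v n)       b       = below-mono inc b
  good-mono inc (c (q , x)) (m , b) = inc m , below-mono inc b

  numbers : List P → List ℕ
  numbers h = concatMap (upTo ∘ Bound) h

  below-∈ : ∀ {h n} → Below h n → n ∈ numbers h
  below-∈ b = ∈-concatMap⁺ (upTo ∘ Bound) (Any.map ∈-upTo⁺ b)

  pool : List P → List (Code K)
  pool h = map v (numbers h) ++ map c (cartesianProduct h (numbers h))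

  good-∈ : ∀ {h} a → Good h a → a ∈ pool h
  good-∈ (v n)           b       = ∈-++⁺ˡ (∈-map⁺ v (below-∈ b))
  good-∈ {h} (c (q , x)) (m , b) = ∈-++⁺ʳ (map v (numbers h)) (∈-map⁺ c (∈-cartesianProduct⁺ m (below-∈ b)))

  statesAt : List P → P → List State
  statesAt h p = map (p ,_) (allVecs (pool h) (N p))

  states : List P → List State
  states h = concatMap (statesAt h) h

  ok-∈ : ∀ {h} x → proj₁ x ∈ h → OkState h x → x ∈ states h
  ok-∈ {h} (p , as) m ok = ∈-concatMap⁺ (statesAt h)
    (Any.map (λ { refl → ∈-map⁺ (p ,_) (∈-allVecs as (All.map (good-∈ _) ok)) }) m)

  below-here : ∀ {h p n} → p ∈ h → n < Bound p → Below h n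
  below-here m l = Any.map (λ { refl → l }) m

  fresh-good : ∀ {h} x → proj₁ x ∈ h → ∀ n → n < maxK → Good h (v (freshes (avoid {K} (proj₂ x)) n))
  fresh-good {h} (p , as) m n l = below-here {h} {p} m (≤-<-trans (freshes-≤ (avoid as) n)
    (≡.subst (λ k → k + n < Bound p) (sym (length-avoid as)) (+-monoʳ-< (suc (N p)) l)))

  look-good : ∀ {h} x → proj₁ x ∈ h → OkState h x → ∀ z → Good h (look (proj₂ x) z)
  look-good {h} (p , as) m ok = look-all {P = Good h} as (below-here {h} {p} m (s≤s z≤n)) ok

  restrict-ok : ∀ h p f → (∀ z → z < N p → Good h (f z)) → OkState h (restrict p f)
  restrict-ok h p f g = tabulate-all (N p) f g

  childCode-good : ∀ {h} x → proj₁ x ∈ h → OkState h x → ∀ t i z → Below h z → Good h (childCode x t i z)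
  childCode-good {h} x m ok (inf _ r _) i z b =
    ρ-all (env x) (λ z → (proj₁ x , z)) (Good h) (look-good x m ok) (fresh-good x m) r i z (m , b)

  -- The child joins the list because a constant introduced by (Subst) is keyed by a variable of the
  -- premise, and this is bounded by `N` of the child.
  child-ok : ∀ {h} x → proj₁ x ∈ h → OkState h x → ∀ i → OkState (proj₁ (child-state x i) ∷ h) (child-state x i)
  child-ok {h} x m ok i = restrict-ok _ (extend (proj₁ x) i) (childCode x (at (proj₁ x)) i)
    (λ z l → childCode-good x (there m) (All.map (good-mono there _) ok) (at (proj₁ x)) i z
               (here (≤-trans l (≤-trans (n≤1+n _) (m≤m+n _ maxK)))))

  comp-ok : ∀ {h} x → proj₁ x ∈ h → OkState h x → ∀ b → OkState (proj₁ (comp-state x b) ∷ h) (comp-state x b)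
  comp-ok {h} x m ok b = restrict-ok _ (companion pp (proj₁ x) b) (look (proj₂ x))
    (λ z _ → good-mono there _ (look-good x m ok z))

  root-ok : OkState (here ∷ []) rootState
  root-ok = restrict-ok _ here v (λ z l → here (≤-trans l (≤-trans (n≤1+n _) (m≤m+n _ maxK))))

  -- Chains of (Subst) and bud edges end; construction of the unfolding.

  -- The recursion measure for the stretches of the construction that produce no inference.
  data SkipAcc : P → Set where
    rule : ∀ {p} → IsRule (at p) → SkipAcc p
    jump : ∀ {p} (b : IsBud (at p)) → SkipAcc (companion pp p b) → SkipAcc p
    sub  : ∀ {p} (h : IsSub (at p)) → SkipAcc (extend p (subIx _ h)) → SkipAcc p

  data Skip : P → P → Set where
    jump : ∀ {p} (b : IsBud (at p)) → Skip p (companion pp p b)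
    sub  : ∀ {p} (h : IsSub (at p)) → Skip p (extend p (subIx _ h))

  data Skip* : P → P → Set where
    nil : ∀ {p} → Skip* p p
    _∷_ : ∀ {p q r} → Skip p q → Skip* q r → Skip* p r

  Skip⁺ : P → P → Set
  Skip⁺ p r = Σ P λ q → Skip p q × Skip* q r

  snoc* : ∀ {p q r} → Skip* p q → Skip q r → Skip* p r
  snoc* nil      s = s ∷ nil
  snoc* (t ∷ ts) s = t ∷ snoc* ts s

  snoc⁺ : ∀ {p q r} → Skip⁺ p q → Skip q r → Skip⁺ p r
  snoc⁺ (_ , t , ts) s = _ , t , snoc* ts s

  skip-edge : ∀ {p q} → Skip p q → Edge pp p q
  skip-edge (jump b) = toComp _ b
  skip-edge (sub h)  = child _ (subIx _ h)

  skip-no-progress : ∀ {p q r C C'} → Skip p q → ¬ Step pp p r C C' true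
  skip-no-progress (jump b) st with step-bud pp b st
  ... | _ , ()
  skip-no-progress {p} (sub h) st with step-child pp st
  ... | inj₁ (i , _ , corr) = sub-no-progress (at p) i h corr
  ... | inj₂ (_ , _ , ())

  module _ (gtc : GlobalTraceCondition pp) where

    -- A cycle of (Subst) and bud edges would be an infinite path without progressing points.
    skip-acyclic : ∀ {p} → ¬ Skip⁺ p p
    skip-acyclic {p} cyc = no-progress (gtc e (λ k → skip-edge (e-skip k)))
      where
      OnCycle : Set
      OnCycle = Σ P λ q → Skip⁺ q p
      turn : OnCycle → OnCycle
      -- The last edge of the cycle leads back to `p`, where the cycle starts over.
      turn (q , r , s , nil)    = r , cyc
      turn (q , r , s , t ∷ ts) = r , _ , t , ts
      turn-skip : ∀ o → Skip (proj₁ o) (proj₁ (turn o))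
      turn-skip (q , r , s , nil)    = s
      turn-skip (q , r , s , t ∷ ts) = s
      orbit : ℕ → OnCycle
      orbit zero    = p , cyc
      orbit (suc k) = turn (orbit k)
      e : ℕ → P
      e k = proj₁ (orbit k)
      e-skip : ∀ k → Skip (e k) (e (suc k))
      e-skip k = turn-skip (orbit k)
      no-progress : ¬ InfProgTrace pp e
      no-progress (k₀ , C , prog , tr , often) with often 0
      ... | k , _ , l , eq =
        skip-no-progress (e-skip k) (≡.subst (Step pp (e k) (e (suc k)) (C k) (C (suc k))) eq (proj₂ (proj₂ (tr k l))))

    -- All positions in `h` lead to `p` through skips, so meeting one of them again would close a
    -- cycle. Each step thus enumerates a new position, and `Noeth` makes the chain end.
    skipAcc-from : ∀ {h} p → (∀ {q} → q ∈ h → Skip⁺ q p) → Noeth P h → SkipAcc p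
    skipAcc-from {h} p inv (step f) with kind (at p) | DecMembership._∈?_ pos-≟ p h
    ... | inj₁ r        | _      = rule r
    ... | inj₂ _        | yes m  = ⊥-elim (skip-acyclic (inv m))
    ... | inj₂ (inj₁ s) | no p∉h = sub s (skipAcc-from _
      (λ { (here refl) → _ , sub s , nil ; (there m) → snoc⁺ (inv m) (sub s) }) (f p p∉h))
    ... | inj₂ (inj₂ b) | no p∉h = jump b (skipAcc-from _
      (λ { (here refl) → _ , jump b , nil ; (there m) → snoc⁺ (inv m) (jump b) }) (f p p∉h))

    skipAcc : ∀ p → SkipAcc p
    skipAcc p = skipAcc-from p (λ ()) (noeth-Pos (tree pp))

    -- Either a new position is visited, or one of the finitely many states over the visited positions
    -- is used up, or a chain of (Subst) and bud edges gets shorter.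
    mutual
      build : ∀ {h} → Noeth P h → ∀ n {H} → length (states h) ≤ n + length H → Unique H →
              (∀ {y} → y ∈ H → proj₁ y ∈ h × OkState h y) →
              ∀ x → OkState (proj₁ x ∷ h) x → SkipAcc (proj₁ x) → UTree H x
      build {h} noeth n bnd uniq inv x ok acc with DecMembership._∈?_ pos-≟ (proj₁ x) h
      ... | no p∉h  = build-new noeth uniq inv x p∉h ok acc
      ... | yes p∈h = build-old noeth n bnd uniq inv x p∈h
                        (All.map (good-mono (λ { (here refl) → p∈h ; (there m) → m }) _) ok) acc

      build-new : ∀ {h} → Noeth P h → ∀ {H} → Unique H → (∀ {y} → y ∈ H → proj₁ y ∈ h × OkState h y) →
                  ∀ x → proj₁ x ∉ h → OkState (proj₁ x ∷ h) x → SkipAcc (proj₁ x) → UTree H x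
      build-new {h} (step f) uniq inv x p∉h ok acc =
        -- A new position enlarges the stock of states, so the budget is set anew while the `Noeth`
        -- derivation shrinks.
        build (f (proj₁ x) p∉h) (length (states (proj₁ x ∷ h))) (m≤m+n _ _) uniq
              (λ m → there (proj₁ (inv m)) , All.map (good-mono there _) (proj₂ (inv m)))
              x (All.map (good-mono there _) ok) acc

      build-old : ∀ {h} → Noeth P h → ∀ n {H} → length (states h) ≤ n + length H → Unique H →
                  (∀ {y} → y ∈ H → proj₁ y ∈ h × OkState h y) →
                  ∀ x → proj₁ x ∈ h → OkState h x → SkipAcc (proj₁ x) → UTree H x
      build-old noeth n bnd uniq inv x p∈h ok (jump b acc) =
        jump b (build noeth n bnd uniq inv (comp-state x b) (comp-ok x p∈h ok b) acc)
      build-old noeth n bnd uniq inv x p∈h ok (sub s acc) =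
        sub s (build noeth n bnd uniq inv (child-state x _) (child-ok x p∈h ok _) acc)
      build-old noeth n {H} bnd uniq inv x p∈h ok (rule r) with DecMembership._∈?_ state-≟ x H
      ... | yes x∈H = back x∈H
      ... | no x∉H  = build-node noeth n bnd uniq inv x p∈h ok r x∉H

      build-node : ∀ {h} → Noeth P h → ∀ n {H} → length (states h) ≤ n + length H → Unique H →
                   (∀ {y} → y ∈ H → proj₁ y ∈ h × OkState h y) →
                   ∀ x → proj₁ x ∈ h → OkState h x → IsRule (at (proj₁ x)) → x ∉ H → UTree H x
      -- The budget is exhausted: `x ∷ H` is duplicate-free and contained in `states h`, which has
      -- at most `length H` members.
      build-node noeth zero {H} bnd uniq inv x p∈h ok r x∉H = ⊥-elim (1+n≰n (≤-trans
        (unique-⊆-length (¬Any⇒All¬ H x∉H ∷ uniq)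
          (λ { (here refl) → ok-∈ x p∈h ok ; {y} (there m) → ok-∈ y (proj₁ (inv m)) (proj₂ (inv m)) })) bnd))
      build-node noeth (suc n) {H} bnd uniq inv x p∈h ok r x∉H = node r (λ i →
        build noeth n (≤-trans bnd (≤-reflexive (sym (+-suc n (length H))))) (¬Any⇒All¬ H x∉H ∷ uniq)
              (λ { (here refl) → p∈h , ok ; (there m) → inv m })
              (child-state x i) (child-ok x p∈h ok i) (skipAcc _))

  -- Validity of the new derivation.

  module _ (atomic : AllSubstAtomic (tree pp)) where

    -- Atomicity enters here: the code of a variable is looked up in the state, and a constant is
    -- recovered from its key and fixed by `⟦ x ⟧s`. The equation ties the key, which refers to the
    -- position, to the tree being matched.
    childCode-sub : ∀ x t → at (proj₁ x) ≡ t → AllSubstAtomic t → (h : IsSub t) → ∀ z →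
                    ⟦ childCode x t (subIx t h) z ⟧c ≡ bindT ⟦ x ⟧s (⟦ theta t h ⟧ z)
    childCode-sub x (inf _ _ _) eq at-w (θ , _ , _ , refl) z = code (⟦ θ ⟧ z) refl (atomic-⟦⟧ (proj₁ at-w) z)
      where
      code : ∀ t → ⟦ θ ⟧ z ≡ t → IsVarOrConst t →
             ⟦ Env.substCode (env x) (λ w → (proj₁ x , w)) z t ⟧c ≡ bindT ⟦ x ⟧s t
      code (var _)   _ _ = refl
      code (fn f ts) e w = trans (cong (λ u → constantAt u z) eq)
                             (trans (cong constant e) (constant-fn ⟦ x ⟧s f ts w))

    childCode-at : ∀ x h z → ⟦ childCode x (at (proj₁ x)) (subIx (at (proj₁ x)) h) z ⟧c ≡ bindT ⟦ x ⟧s (⟦ theta (at (proj₁ x)) h ⟧ z)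
    childCode-at x h = childCode-sub x (at (proj₁ x)) refl (atomic-at (proj₁ x) atomic) h

    validAt : ∀ p → Valid (at p)
    validAt p = valid-at p (valid pp)

    lab-child : ∀ x i → lab (child-state x i) ≈S substS (⟦_⟧c ∘ childCode x (at (proj₁ x)) i) (premT (at (proj₁ x)) i)
    lab-child x i = ≈S-trans
      (≈S-reflexive (trans (lab-restrict (extend (proj₁ x) i) (childCode x (at (proj₁ x)) i))
                           (cong (substS (⟦_⟧c ∘ childCode x (at (proj₁ x)) i) ∘ label) (at-extend (proj₁ x) i))))
      (substS-≈ (⟦_⟧c ∘ childCode x (at (proj₁ x)) i) (child-label (at (proj₁ x)) (validAt (proj₁ x)) i))

    lab-sub : ∀ x h → lab x ≈S lab (child-state x (subIx _ h))
    lab-sub x h = ≈S-trans (substS-≈ ⟦ x ⟧s (sub-label _ (validAt (proj₁ x)) h))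
      (≈S-trans
        (≈S-reflexive (trans (substS-substS ⟦ x ⟧s ⟦ theta (at (proj₁ x)) h ⟧ _) (substS-bounded _ (λ z _ → sym (childCode-at x h z)))))
        (≈S-sym (lab-child x (subIx _ h))))

    lab-comp : ∀ x b → lab x ≈S lab (comp-state x b)
    lab-comp x b = ≈S-trans (substS-≈ ⟦ x ⟧s (≈S-sym (compSeq pp (proj₁ x) b)))
                            (≈S-reflexive (sym (lab-restrict (companion pp (proj₁ x) b) (look (proj₂ x)))))

    label-toTree : ∀ {H x} (u : UTree H x) → lab x ≈S label (toTree u)
    label-toTree         (back _)   = ≈S-refl
    label-toTree {x = x} (jump b u) = ≈S-trans (lab-comp x b) (label-toTree u)
    label-toTree {x = x} (sub h u)  = ≈S-trans (lab-sub x h) (label-toTree u)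
    label-toTree         (node _ _) = ≈S-refl

    toTree-valid : ∀ {H x} (u : UTree H x) → Valid (toTree u)
    toTree-valid (back _)   = tt
    toTree-valid (jump _ u) = toTree-valid u
    toTree-valid (sub _ u)  = toTree-valid u
    toTree-valid {x = x} (node h us) =
      ≈S-trans (substS-≈ ⟦ x ⟧s (rule-label _ (validAt (proj₁ x)) h)) (≈S-reflexive (sym (trT-conclusion x _ h))) ,
      λ i → ≈S-trans (≈S-sym (label-toTree (us (ιT x _ h i))))
              (≈S-trans (lab-child x (ιT x _ h i)) (≈S-reflexive (sym (trT-premise x _ h i)))) ,
            toTree-valid (us (ιT x _ h i))

    -- Projection of paths to the given proof and transfer of traces back.

    OK : P → Formula → Set
    OK p C = IsIndAtom C × C ∈ ante (label (at p))

    open Paths P Formula (Edge pp) (Step pp) OK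

    trace-ok : ∀ {p q} {π : Path p q} {C D b} → Trace π C D b → OK p C
    trace-ok (nil ok)       = ok
    trace-ok ((ok , _) ∷ _) = ok

    skipPath : ∀ {H x} (u : UTree H x) → Path (proj₁ x) (proj₁ (stateAt u here))
    skipPath         (back _)   = nil
    skipPath {x = x} (jump b u) = toComp (proj₁ x) b ∷ skipPath u
    skipPath {x = x} (sub h u)  = child (proj₁ x) (subIx _ h) ∷ skipPath u
    skipPath         (node _ _) = nil

    -- At (Subst) the change of the formula is made up for by the change of the substitution; at a
    -- bud the formula is kept and the substitution agrees on its free variables. Neither edge
    -- progresses.
    skip-trace : ∀ {H x} (u : UTree H x) {C D b} → Trace (skipPath u) C D b →
                 b ≡ false × substF ⟦ x ⟧s C ≡ substF ⟦ stateAt u here ⟧s D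
    skip-trace (back _)   (nil _) = refl , refl
    skip-trace (node _ _) (nil _) = refl , refl
    skip-trace {x = x} (jump b u) {C} (_∷_ {b' = b'} (_ , st) tr) with step-bud pp b st | skip-trace u tr
    ... | refl , refl | refl , e = refl ,
      trans (sym (ante-restrict (companion pp (proj₁ x) b) (look (proj₂ x)) (proj₂ (trace-ok tr)))) e
    skip-trace {x = x} (sub h u) {C} (_∷_ {C' = C'} (_ , st) tr)
      with sub-corr _ h (step-corr pp (subIx _ h) st) | skip-trace u tr
    ... | refl , refl | refl , e = refl , trans (substF-substF ⟦ x ⟧s ⟦ theta (at (proj₁ x)) h ⟧ C')
      (trans (substF-cong (λ z → sym (childCode-at x h z)) C')
      (trans (sym (ante-restrict (extend (proj₁ x) (subIx _ h)) (childCode x (at (proj₁ x)) (subIx (at (proj₁ x)) h)) (proj₂ (trace-ok tr)))) e))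

    -- The projection of one edge of the new proof. `R` stands for the trace relation of that edge,
    -- so `transfer` runs opposite to the projection.
    record Link (x y : State) (R : Formula → Formula → Bool → Set) : Set where
      field
        path     : Path (proj₁ x) (proj₁ y)
        transfer : ∀ {C D b} → Trace path C D b → R (substF ⟦ x ⟧s C) (substF ⟦ y ⟧s D) b
    open Link

    childLink : ∀ {H x} (u : UTree H x) p i →
                Σ (Link (stateAt u p) (stateAt u (extend p i)) (CorrT (at p) i)) λ l → NonEmpty (path l)
    childLink (back _)   here ()
    childLink (jump _ u) p i = childLink u p i
    childLink (sub _ u)  p i = childLink u p i
    childLink (node h us) (there j p) i = childLink (us _) p i
    childLink {x = x} (node h us) here i = record { path = child (proj₁ x) j ∷ skipPath (us j) ; transfer = go } , tt
      where
      j = ιT x (at (proj₁ x)) h i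
      go : ∀ {C D b} → Trace (child (proj₁ x) j ∷ skipPath (us j)) C D b →
           Corr (trT x (at (proj₁ x)) h) i (substF ⟦ x ⟧s C) (substF ⟦ stateAt (us j) here ⟧s D) b
      go {C} (_∷_ {C' = C'} {b = b} ((_ , m) , st) tr) with skip-trace (us j) tr
      ... | refl , e = ≡.subst₂ (Corr (trT x (at (proj₁ x)) h) i (substF ⟦ x ⟧s C))
        (trans (sym (ante-restrict (extend (proj₁ x) j) (childCode x (at (proj₁ x)) j) (proj₂ (trace-ok tr)))) e)
        (sym (∨-identityʳ b))
        (trT-corr x _ h i (proj₁ (proj₁ (rule-label _ (validAt (proj₁ x)) h)) C m) (step-corr pp j st))

    module _ (u : UTree [] rootState) where

      companion' : ∀ p → IsBud (at p) → Σ (Pos (toTree u)) λ q → IsInf (at q) × stateAt u q ≡ stateAt u p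
      companion' p b with comp u p b
      ... | inj₁ q = q

      unfolded : PreProof
      unfolded = record
        { tree      = toTree u
        ; valid     = toTree-valid u
        ; companion = λ p b → proj₁ (companion' p b)
        ; compInf   = λ p b → proj₁ (proj₂ (companion' p b))
        ; compSeq   = λ p b → ≈S-reflexive (trans (label-at u _)
                        (trans (cong lab (proj₂ (proj₂ (companion' p b)))) (sym (label-at u p))))
        }

      -- The two states are variables so that their equality can be matched, after which the empty
      -- path joins them.
      compLink : ∀ {x y p b} → y ≡ x → stateAt u p ≡ x → Link x y (Step unfolded p (companion unfolded p b))
      compLink {b = b} refl refl = record { path = nil ; transfer = λ { (nil _) → compS _ b _ } }

      link : ∀ {p q} → Edge unfolded p q → Link (stateAt u p) (stateAt u q) (Step unfolded p q)
      link (child p i) = record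
        { path     = path (proj₁ (childLink u p i))
        ; transfer = λ tr → childS p i (transfer (proj₁ (childLink u p i)) tr)
        }
      link (toComp p b) = compLink (proj₂ (proj₂ (companion' p b))) refl

      link-nonEmpty : ∀ {p q} → IsInf (at p) → (e : Edge unfolded p q) → NonEmpty (path (link e))
      link-nonEmpty w (child p i)  = proj₂ (childLink u p i)
      link-nonEmpty w (toComp p b) = ⊥-elim (bud-not-inf (at p) b w)

      -- Empty paths come from bud edges only, and such an edge ends at an inference, whose outgoing
      -- edges have nonempty paths.
      link-nonEmpty-or-inf : ∀ {p q} → (e : Edge unfolded p q) → NonEmpty (path (link e)) ⊎ IsInf (at q)
      link-nonEmpty-or-inf (child p i)  = inj₁ (proj₂ (childLink u p i))
      link-nonEmpty-or-inf (toComp p b) = inj₂ (compInf unfolded p b)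

      unfolded-gtc : GlobalTraceCondition pp → GlobalTraceCondition unfolded
      unfolded-gtc gtc e path-e = result (hasPathTrace old)
        where
        π : ∀ k → Path (proj₁ (stateAt u (e k))) (proj₁ (stateAt u (e (suc k))))
        π k = path (link (path-e k))
        ne : ∀ k → NonEmpty (π k) ⊎ NonEmpty (π (suc k))
        ne k with link-nonEmpty-or-inf (path-e k)
        ... | inj₁ h = inj₁ h
        ... | inj₂ w = inj₂ (link-nonEmpty w (path-e (suc k)))
        open Flatten (λ k → proj₁ (stateAt u (e k))) π ne
        old : HasTrace flat
        old with gtc flat (vert-edge 0 (π 0))
        ... | k₀ , C , prog , tr , often =
          k₀ , C , prog , (λ k l → (proj₁ (tr k l) , proj₁ (proj₂ (tr k l))) , proj₂ (proj₂ (tr k l))) , often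
        result : HasPathTrace (λ k → proj₁ (stateAt u (e k))) π → InfProgTrace unfolded e
        result (k₀ , C , prog , tr , often) =
          k₀ , (λ k → substF ⟦ stateAt u (e k) ⟧s (C k)) , prog ,
          (λ k l → isIndAtom-substF ⟦ stateAt u (e k) ⟧s (C k) (proj₁ (trace-ok (tr k l))) ,
                   ≡.subst (substF ⟦ stateAt u (e k) ⟧s (C k) ∈_) (cong ante (sym (label-at u (e k))))
                     (∈-map⁺ (substF ⟦ stateAt u (e k) ⟧s) (proj₂ (trace-ok (tr k l)))) ,
                   transfer (link (path-e k)) (tr k l)) ,
          often

theorem3 : (S : Signature) (Φ : List (Syntax.Production S))
    (Γ Δ : List (Syntax.Formula S))
    (Pr : Calculus.Proof S Φ (Syntax._⊢_ Γ Δ)) →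
    Calculus.SubstAtomicProof S Φ Pr →
    Σ (Calculus.Proof S Φ (Syntax._⊢_ Γ Δ)) λ Pr' →
    ¬ Calculus.UsesProof S Φ Pr' Subst
    × (∀ n → Calculus.UsesProof S Φ Pr' n → Calculus.UsesProof S Φ Pr n)
theorem3 S Φ Γ Δ Pr atomic =
  record
    { preproof = unfolded atomic u
    ; root     = ≈S-trans (≈S-sym (label-toTree atomic u)) (≈S-trans (≈S-reflexive lab-root) (root Pr))
    ; gtc      = unfolded-gtc atomic u (gtc Pr)
    } ,
  (λ w → proj₁ (toTree-uses u w) refl) ,
  (λ n w → proj₂ (toTree-uses u w))
  where
  open Calculus S Φ
  open SyntaxProperties S
  open CalculusProperties S Φ
  open Unfolding S Φ (preproof Pr)
  u : UTree [] rootState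
  -- No position has been visited yet, so the root counts as new and the first call sets the budget
  -- for it.
  u = build (gtc Pr) (noeth-Pos (tree (preproof Pr))) (length (states [])) (m≤m+n _ _) [] (λ ())
            rootState root-ok (skipAcc (gtc Pr) here)
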